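{- For any integer $n>24$, any $d>r$ (where $r>0$ is the range of transmission and $d$ is the Geocast eccentricity), any integers $\alpha\ge 0$, $\beta>0$, any $V_{\max}>\pi r/(6\alpha)$, and any fair randomized Geocast protocol $\mathcal{P}$, there exists an $(\alpha,\beta)$-connected MANET of $n$ nodes (node speeds bounded by $V_{\max}$) for which, in order to solve the problem with probability at least $2^{ -n/2}$, $\mathcal{P}$ takes at least $$\frac{\alpha n}{2}+\frac{n^2}{96\ln(n/2)}$$ time slots.
   Context: **Model.** A MANET is a set $V$ of $n$ nodes in $\mathbb{R}^2$, no two at the same point at the same time. Time is divided into slots $1,2,\dots$; positions (hence topology) change only at slot boundaries, and no node moves faster than $V_{\max}$ (measured as distance per time slot). All nodes have the same range of transmission $r>0$; two nodes are neighbors in a slot if their distance is at most $r$ during the whole slot. An active node $u$ receives a transmission from a neighbor $v$ in a slot if and only if $v$ is the only node transmitting in that slot among $u$ and its neighbors. There is no collision detection. Nodes may be activated at any slot boundary, and may fail (become inactive) and be reactivated; upon activation a node starts its algorithm from scratch, keeping no state. Slots counted from a node's activation are its (local) steps. **Geocast.** A source node $s$ holds a piece of information $I$ at time $t_1$. $I$ must be delivered to all nodes that at time $t_1$ are active and located within distance $d$ (the eccentricity) of the position of $s$ at that time. A node is covered if it has received $I$ (the source counts as covered from $t_1$), otherwise uncovered. A node is informed at time $t$ if it holds $I$ at time $t$. The problem is solved at slot $t_2\ge t_1$ if all target nodes are covered by slot $t_2$; the time taken is counted in slots from $t_1$. **$(\alpha,\beta)$-connectivity** (integers $\alpha\ge0$,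 $\beta\ge1$). For every slot $t\ge t_1$ at which the problem is not yet solved there is a slot $t'$ such that $[t,t+\alpha]\cap[t',t'+\beta)\neq\emptyset$, and there are nodes $p,p'$ such that at time $t'$ $p$ is informed and $p'$ is uncovered, and $p,p'$ are active and neighbors from step $t'$ until $p'$ becomes covered or until step $t'+\beta-1$ (inclusive), whichever occurs first. **Adversary.** Placement, movement and activation schedule (and the instance: source and $t_1$) are chosen by an adaptive adversary, which decides at the end of each slot with access to the protocol and all nodes' internal states but not to future random bits, subject to the speed bound and $(\alpha,\beta)$-connectivity. "There exists an $(\alpha,\beta)$-connected MANET" means that there is such an adversary strategy. Probability is over the protocol's random bits. **Protocols.** Protocols are conditional: a node does not transmit before it is covered. A randomized protocol is fair if in every execution and every (global) time slot all covered nodes transmit with the same probability (this common probability may depend on the slot and on the execution). For $\alpha=0$ the quantity $\pi r/(6\alpha)$ is read as $+\infty$ (here $\pi$ is the circle constant). -}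

module Defs where

open import Level using (0ℓ)
open import Algebra.Apartness.Bundles using (HeytingField; HeytingCommutativeRing)
import Algebra.Definitions.RawSemiring as RawSemiringDefs
open import Algebra.Bundles using (Semiring; CommutativeRing)
open import Data.Bool.Base using (Bool; true; false; T; _∧_; _∨_; if_then_else_)
open import Data.Bool.Properties using (T?)
open import Data.Fin.Base as Fin using (Fin; toℕ)
open import Data.Fin.Properties as Fin using (all?)
open import Data.List.Base using (List; []; _∷_; foldr; map; mapMaybe; length; allFin)
open import Data.List.Membership.Propositional using (_∈_)
open import Data.List.Relation.Unary.All using (All)
open import Data.Maybe.Base as Maybe using (Maybe; just; nothing; is-just; maybe′; fromMaybe; _>>=_)
open import Data.Nat.Base as ℕ using (ℕ; zero; suc; NonZero; _!)
open import Data.Nat.Properties using (_!≢0) renaming (_≟_ to _≟ℕ_)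
open import Data.Product.Base using (∃-syntax; _×_; _,_; proj₁; proj₂)
open import Data.Sum.Base using (_⊎_)
open import Data.Vec.Base using (Vec; []; _∷_; lookup)
open import Function.Bundles using (_⇔_; Equivalence)
open import Relation.Binary.Core using (Rel)
open import Relation.Binary.Definitions using (Cotransitive)
open import Relation.Binary.PropositionalEquality.Core using (_≡_; _≢_)
open import Relation.Binary.Structures using (IsStrictPartialOrder)
open import Relation.Nullary using (¬_; Dec; does)
open import Relation.Nullary.Decidable using (_→-dec_)

-- The real numbers, axiomatised as a Cauchy-complete Archimedean ordered
-- Heyting field.  Classically ℝ is the only such structure up to isomorphism.
-- The order is only assumed cotransitive (not decidable), so that the
-- constructive Cauchy reals are also an instance.
record Reals : Set₁ where
  field
    heytingField : HeytingField 0ℓ 0ℓ 0ℓ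

  open HeytingField heytingField public renaming (Carrier to ℝ)

  semiring : Semiring 0ℓ 0ℓ
  semiring = CommutativeRing.semiring
    (HeytingCommutativeRing.commutativeRing heytingCommutativeRing)

  open RawSemiringDefs (Semiring.rawSemiring semiring) public
    using (_^_; sum) renaming (_×_ to _·_)

  fromℕ : ℕ → ℝ
  fromℕ m = m · 1#

  infix 4 _<_ _≤_
  field
    _<_                  : Rel ℝ 0ℓ
    <-isStrictPartialOrder : IsStrictPartialOrder _≈_ _<_
    <-cotrans            : Cotransitive _<_
    #⇔<⊎>                : ∀ x y → (x # y) ⇔ (x < y ⊎ y < x)
    0<1                  : 0# < 1#
    +-monoˡ-<            : ∀ z {x y} → x < y → x + z < y + z
    *-pos                : ∀ {x y} → 0# < x → 0# < y → 0# < x * y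
    archimedean          : ∀ x → ∃[ m ] x < fromℕ m

  _≤_ : Rel ℝ 0ℓ
  x ≤ y = ¬ (y < x)

  -- |f i - L| < 1/k and |f i - f j| < 1/k, multiplied through by k.
  Converges : (ℕ → ℝ) → ℝ → Set
  Converges f L = ∀ k → ∃[ N ] ∀ i → N ℕ.≤ i →
    (fromℕ k * (f i - L) < 1#) × (fromℕ k * (L - f i) < 1#)

  Cauchy : (ℕ → ℝ) → Set
  Cauchy f = ∀ k → ∃[ N ] ∀ i j → N ℕ.≤ i → N ℕ.≤ j →
    fromℕ k * (f i - f j) < 1#

  field
    complete : ∀ f → Cauchy f → ∃[ L ] Converges f L

module RealFunctions (R : Reals) where

  open Reals R
  open IsStrictPartialOrder <-isStrictPartialOrder
    using (<-respʳ-≈; <-respˡ-≈) renaming (trans to <-trans)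

  0<fromℕ-suc : ∀ m → 0# < fromℕ (suc m)
  0<fromℕ-suc zero    = <-respʳ-≈ (sym (+-identityʳ 1#)) 0<1
  0<fromℕ-suc (suc m) = <-trans (0<fromℕ-suc m)
    (<-respˡ-≈ (+-identityˡ _) (+-monoˡ-< (fromℕ (suc m)) 0<1))

  fromℕ#0 : ∀ m .{{_ : NonZero m}} → fromℕ m # 0#
  fromℕ#0 (suc m) = #-sym (Equivalence.from (#⇔<⊎> _ _) (_⊎_.inj₁ (0<fromℕ-suc m)))

  recipℕ : ∀ m .{{_ : NonZero m}} → ℝ
  recipℕ m = proj₁ (#⇒invertible (fromℕ#0 m))

  infixl 7 _/ℕ_
  _/ℕ_ : ℝ → ∀ m .{{_ : NonZero m}} → ℝ
  x /ℕ m = x * recipℕ m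

  _/_! : ℝ → ℕ → ℝ
  x / k ! = _/ℕ_ x (k !) {{k !≢0}}

  partialSum : (ℕ → ℝ) → ℕ → ℝ
  partialSum f N = sum {n = N} (λ k → f (toℕ k))

  -- The elementary functions are given by their graphs.
  IsExp : ℝ → ℝ → Set
  IsExp x y = Converges (partialSum (λ k → (x ^ k) / k !)) y

  IsCos : ℝ → ℝ → Set
  IsCos x y = Converges
    (partialSum (λ k → ((- 1#) ^ k * x ^ (2 ℕ.* k)) / (2 ℕ.* k) !)) y

  IsLn : ℝ → ℝ → Set
  IsLn x l = IsExp l x

  -- Twice the least positive zero of cos.
  IsPi : ℝ → Set
  IsPi p = 0# < p × IsCos (p /ℕ 2) 0#
         × (∀ x c → 0# ≤ x → x < p /ℕ 2 → IsCos x c → 0# < c)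

  IsSqrt : ℝ → ℝ → Set
  IsSqrt x s = 0# ≤ s × s * s ≈ x

  Point : Set
  Point = ℝ × ℝ

  -- Euclidean distance at most ρ.
  Within : ℝ → Point → Point → Set
  Within ρ (x , y) (x′ , y′) =
    0# ≤ ρ × (x - x′) * (x - x′) + (y - y′) * (y - y′) ≤ ρ * ρ

  SamePoint : Point → Point → Set
  SamePoint (x , y) (x′ , y′) = x ≈ x′ × y ≈ y′

  -- Finitely supported distributions, listing positive-weight outcomes only.
  Weighted : Set → Set
  Weighted A = List (ℝ × A)

  outcomes : {A : Set} → Weighted A → List A
  outcomes = map proj₂

  𝔼 : {A : Set} → Weighted A → (A → ℝ) → ℝ
  𝔼 D f = foldr (λ (w , a) acc → w * f a + acc) 0# D

  IsDistribution : {A : Set} → Weighted A → Set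
  IsDistribution D = All (λ (w , _) → 0# < w) D × 𝔼 D (λ _ → 1#) ≈ 1#

  indicator : Bool → ℝ
  indicator b = if b then 1# else 0#

  -- Expectation under independent draws.
  𝔼-joint : {A : Set} {n : ℕ} → (Fin n → Weighted A) → (Vec A n → ℝ) → ℝ
  𝔼-joint {n = zero}  D f = f []
  𝔼-joint {n = suc n} D f =
    𝔼 (D Fin.zero) λ a → 𝔼-joint (λ u → D (Fin.suc u)) λ as → f (a ∷ as)

-- Slots are numbered 0, 1, 2, …; "time t" is the beginning of slot t, after
-- the adversary has made its changes at that slot boundary.
module Geocast (R : Reals) (n : ℕ) (r d Vmax : Reals.ℝ R) where

  open Reals R
  open RealFunctions R

  Node : Set
  Node = Fin n

  -- What a node receives in a slot: whether I is included (it is exactly when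
  -- the transmitter holds I), and the rest of the message.
  Reception : Set → Set
  Reception Msg = Bool × Msg

  -- The result of a node's random bits of one slot.  They may be used both for
  -- deciding what to transmit and for updating the state at the end.
  record Action (State Msg : Set) : Set where
    field
      send : Maybe Msg
      next : Maybe (Reception Msg) → State

  open Action public

  record Protocol : Set₁ where
    field
      State  : Set
      Msg    : Set
      boot   : Node → State              -- state upon (re)activation
      learn  : State → State             -- the source is handed I
      behave : ℕ → State → Weighted (Action State Msg)
                                         -- the first argument is the current slot
      behave-isDistribution : ∀ t σ → IsDistribution (behave t σ)

  -- Constructively the distance comparisons are not decidable, so the
  -- configuration comes with their truth values; classically this is no data.
  record Config : Set where
    field
      pos     : Node → Point
      active  : Node → Bool
      near?   : ∀ u v → Dec (Within r (pos u) (pos v))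
      inArea? : ∀ u v → Dec (Within d (pos u) (pos v))

  open Config public

  Neighbours : Config → Node → Node → Set
  Neighbours c u v = u ≢ v × Within r (pos c u) (pos c v)

  module Execution (𝓟 : Protocol) where

    open Protocol 𝓟

    -- One entry per node; nothing for a node that is inactive in the slot.
    Draws : Set
    Draws = Vec (Maybe (Action State Msg)) n

    -- Random outcomes of the slots elapsed, latest first: a history of
    -- length t precedes slot t.
    History : Set
    History = List Draws

    -- Given an adversary, the past random outcomes determine the past
    -- configurations and the internal states of all nodes.
    record Adversary : Set where
      field
        source : Node
        t₁     : ℕ
        move   : History → Config

    open Adversary public

    -- covered and target refer to the whole past; informed is lost on failure.
    record World : Set where
      field
        state    : Node → Maybe State    -- nothing: inactive
        informed : Node → Bool
        covered  : Node → Bool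
        target   : Node → Bool

    open World public

    blank : World
    blank = record
      { state    = λ _ → nothing
      ; informed = λ _ → false
      ; covered  = λ _ → false
      ; target   = λ _ → false
      }

    activation : Config → World → World
    activation c w = record w
      { state    = λ u → if active c u then just (fromMaybe (boot u) (state w u)) else nothing
      ; informed = λ u → active c u ∧ informed w u
      }

    launch : Node → Config → World → World
    launch s c w = record
      { state    = λ u → if isSource u then Maybe.map learn (state w u) else state w u
      ; informed = λ u → isSource u ∨ informed w u
      ; covered  = λ u → isSource u ∨ covered w u
      ; target   = λ u → active c u ∧ does (inArea? c s u)
      }
      where
      isSource : Node → Bool
      isSource u = does (u Fin.≟ s)

    boundary : Adversary → ℕ → Config → World → World
    boundary A t c w =
      if does (t ≟ℕ t₁ A) then launch (source A) c (activation c w) else activation c w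

    -- All transmissions made by u itself or by a neighbour of u.
    transmissionsAround : Config → Draws → Node → List (Node × Msg)
    transmissionsAround c as u = mapMaybe
      (λ v → if does (near? c u v)
             then Maybe.map (v ,_) (lookup as v >>= send)
             else nothing)
      (allFin n)

    received : Config → World → Draws → Node → Maybe (Reception Msg)
    received c w as u =
      if active c u then unique (transmissionsAround c as u) else nothing
      where
      unique : List (Node × Msg) → Maybe (Reception Msg)
      unique ((v , m) ∷ []) =
        if does (v Fin.≟ u) then nothing else just (informed w v , m)
      unique _ = nothing

    play : Config → Draws → World → World
    play c as w = record w
      { state    = λ u → Maybe.map (λ a → next a (received c w as u)) (lookup as u)
      ; informed = λ u → informed w u ∨ getsI u
      ; covered  = λ u → covered w u ∨ getsI u
      }
      where
      getsI : Node → Bool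
      getsI u = maybe′ proj₁ false (received c w as u)

    mutual
      at : Adversary → History → World
      at A h = boundary A (length h) (move A h) (after A h)

      after : Adversary → History → World
      after A []       = blank
      after A (as ∷ h) = play (move A h) as (at A h)

    draws : Adversary → History → Node → Weighted (Maybe (Action State Msg))
    draws A h u = maybe′
      (λ σ → map (λ (w , a) → w , just a) (behave (length h) σ))
      ((1# , nothing) ∷ [])
      (state (at A h) u)

    data Reachable (A : Adversary) : History → Set where
      []  : Reachable A []
      _∷_ : ∀ {as h} → (∀ u → lookup as u ∈ outcomes (draws A h u)) →
            Reachable A h → Reachable A (as ∷ h)

    record Legal (A : Adversary) : Set where
      field
        distinct      : ∀ {h} → Reachable A h → ∀ u v → u ≢ v →
                        ¬ SamePoint (pos (move A h) u) (pos (move A h) v)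
        speed         : ∀ {as h} → Reachable A (as ∷ h) → ∀ u →
                        Within Vmax (pos (move A h) u) (pos (move A (as ∷ h)) u)
        source-active : ∀ {h} → Reachable A h → length h ≡ t₁ A →
                        active (move A h) (source A) ≡ true

    Solved : World → Set
    Solved w = ∀ u → T (target w u) → T (covered w u)

    solved? : ∀ w → Dec (Solved w)
    solved? w = all? λ u → T? (target w u) →-dec T? (covered w u)

    prefix : (ℕ → Draws) → ℕ → History
    prefix ω zero    = []
    prefix ω (suc t) = ω t ∷ prefix ω t

    worldAt : Adversary → (ℕ → Draws) → ℕ → World
    worldAt A ω t = at A (prefix ω t)

    configAt : Adversary → (ℕ → Draws) → ℕ → Config
    configAt A ω t = move A (prefix ω t)

    Connected : ℕ → ℕ → Adversary → Set
    Connected α β A =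
      ∀ (ω : ℕ → Draws) → (∀ t → Reachable A (prefix ω t)) →
      ∀ t → t₁ A ℕ.≤ t → ¬ Solved (worldAt A ω t) →
      ∃[ t′ ]
        (∃[ τ ] (t ℕ.≤ τ × τ ℕ.≤ t ℕ.+ α × t′ ℕ.≤ τ × τ ℕ.< t′ ℕ.+ β)) ×
        (∃[ p ] ∃[ p′ ]
          (informed (worldAt A ω t′) p ≡ true × covered (worldAt A ω t′) p′ ≡ false ×
           (∀ τ → t′ ℕ.≤ τ → τ ℕ.< t′ ℕ.+ β → covered (worldAt A ω τ) p′ ≡ false →
             active (configAt A ω τ) p ≡ true × active (configAt A ω τ) p′ ≡ true ×
             Neighbours (configAt A ω τ) p p′)))

    -- The probability that, after k further slots, the problem is solved.
    prSolved : Adversary → ℕ → History → ℝ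
    prSolved A zero    h = indicator (does (solved? (at A h)))
    prSolved A (suc k) h = 𝔼-joint (draws A h) λ as → prSolved A k (as ∷ h)

    prSolvedWithin : Adversary → ℕ → ℝ
    prSolvedWithin A T = prSolved A (t₁ A ℕ.+ T) []

    Conditional : Set
    Conditional = ∀ A → Legal A → ∀ h → Reachable A h → ∀ u σ →
      state (at A h) u ≡ just σ → covered (at A h) u ≡ false →
      ∀ a → a ∈ outcomes (behave (length h) σ) → send a ≡ nothing

    prTransmit : ℕ → State → ℝ
    prTransmit t σ = 𝔼 (behave t σ) λ a → indicator (is-just (send a))

    -- Active nodes covered during their current activation, i.e. informed ones.
    -- A node reactivated from scratch cannot be told apart from one that was
    -- never covered and must therefore be silent; requiring it to transmit with
    -- the common probability would leave hardly any fair protocols.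
    Fair : Set
    Fair = ∀ A → Legal A → ∀ h → Reachable A h → ∀ u v σ σ′ →
      state (at A h) u ≡ just σ  → informed (at A h) u ≡ true →
      state (at A h) v ≡ just σ′ → informed (at A h) v ≡ true →
      prTransmit (length h) σ ≈ prTransmit (length h) σ′

-- Half of the nodes (the helpers) are gathered around the source until all of
-- them are informed.  The other nodes wait just out of range and are attacked
-- one by one: the attacked node is active together with the helpers, and either
-- only the source or all helpers move into its range.  By fairness all helpers
-- transmit with the same probability p, which the adversary knows: for small p
-- it lets only the source in range, who probably stays silent; for large p it
-- lets all helpers in range, and probably several of them collide.  Either way
-- the attacked node is covered with probability at most c = 8 ln(n/2) / n.  It is
-- then switched off, and α slots pass before the next attack.  Weighting a state
-- with i idle slots and j > 0 uncovered nodes ahead by (1 + 3c)^(i + (j-1)α) 4^j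
-- gives P(solved within T) (1 + 3c)^(αm) 4^m ≤ (1 + 3c)^T for m = ⌈n/2⌉.  If
-- T - αm < n² / (96 ln(n/2)), then (1 + 3c)^(T - αm) ≤ (4/3)^n, so that this
-- probability is at most (4/9)^(n/2) < 2^(-n/2).
module Submission where

open import Algebra.Apartness.Bundles using (HeytingCommutativeRing)
open import Algebra.Bundles using (CommutativeRing; CommutativeSemiring)
open import Data.Bool.Base using (Bool; true; false; T; if_then_else_; _∧_; _∨_; not)
open import Data.Bool.Properties using (T?; T-≡; ∨-zeroʳ; ∧-zeroʳ)
open import Data.Empty using (⊥-elim)
open import Data.Fin.Base as Fin using (Fin; toℕ; fromℕ<)
import Data.Fin.Properties as Fin
open import Data.List.Base using (List; []; _∷_; map; mapMaybe; allFin; length)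
open import Data.List.Membership.Propositional using (_∈_)
open import Data.List.Membership.Propositional.Properties using (∈-allFin)
open import Data.List.Relation.Unary.All using (All; []; _∷_)
open import Data.List.Relation.Unary.Any using (here; there)
open import Data.Maybe.Base as Maybe using (Maybe; just; nothing; is-just; maybe′; fromMaybe; _>>=_)
open import Data.Nat.Base as ℕ using (ℕ; zero; suc; NonZero; _!; _∸_; ∣_-_∣; _<ᵇ_; _≡ᵇ_; ⌊_/2⌋; ⌈_/2⌉)
import Data.Nat.Properties as ℕ
open import Data.Product.Base using (∃-syntax; _×_; _,_; proj₁; proj₂)
open import Data.Sum.Base using (_⊎_; inj₁; inj₂)
open import Data.Vec.Base using (Vec; []; _∷_; lookup)
open import Function.Base using (_∘_)
open import Function.Bundles using (Equivalence)
open import Relation.Binary.PropositionalEquality.Core as ≡ using (_≡_; _≢_)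
open import Relation.Binary.Structures using (IsStrictPartialOrder; IsPreorder)
open import Relation.Nullary using (¬_; contradiction; yes; no; Dec; does)
open import Relation.Nullary.Decidable using (map′; _→-dec_; dec-true; dec-false)
open import Defs

-- Two features of the setting shape the argument. The order of the reals is only cotransitive, so
-- the adversary cannot test whether p < c. It keeps a second threshold c′ < c and obtains c′ < p or
-- p < c by cotransitivity; hence the crowd must already collide often enough at c′ = 7 ln(n/2) / n.
-- Inequalities, being negations, still admit classical case distinctions. Comparing distances would
-- be undecidable as well: placing all nodes on a lattice of spacing r/K on one line reduces it to
-- natural numbers, and a large K makes any positive speed sufficient for the shift of a helper.
-- Logarithm and exponential are given by their graphs, so the estimates are made on truncated
-- series, in the product form exp(x) (1 - b)^M ≤ 1 for x ≤ M b. The weight 4^j is tied to the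
-- factor 1 + 3c: a hit lowers the weight by a factor 4, and 1 + 3[hit] has mean at most 1 + 3c.
-- Base 4 is large enough because 1/2 · 4 · (3/4)² = 9/8 > 1. In 96 = 4 · 3 · 8 the 4 comes from
-- exp(n/4) ≤ (4/3)^n, the 3 from 3c and the 8 from c itself.

-- Ordered-field arithmetic with an undecidable order

module OrderedFieldProperties (R : Reals) where

  open Reals R hiding (zero)
  open IsStrictPartialOrder <-isStrictPartialOrder public
    using (<-respʳ-≈; <-respˡ-≈; <-resp-≈)
    renaming (trans to <-trans; irrefl to <-irrefl; asym to <-asym)

  commutativeRing : CommutativeRing _ _
  commutativeRing = HeytingCommutativeRing.commutativeRing heytingCommutativeRing

  commutativeSemiring : CommutativeSemiring _ _
  commutativeSemiring = CommutativeRing.commutativeSemiring commutativeRing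

  open import Algebra.Properties.Semiring.Mult semiring public
    using () renaming (×-homo-+ to ·-homo-+; ×1-homo-* to ·1-homo-*)
  open import Algebra.Properties.Semiring.Exp semiring public
    using (^-congˡ; ^-homo-*)
  open import Algebra.Solver.Ring.NaturalCoefficients.Default commutativeSemiring public
    using (solve; _:=_; _:+_; _:*_; con)

  open import Algebra.Properties.CommutativeSemiring.Exp commutativeSemiring public
    using (^-distrib-*)

  -- Refuting both strict comparisons refutes apartness, and tightness turns that into equality.
  ¬¬-compare : ∀ x y → ¬ ¬ (x < y ⊎ x ≈ y ⊎ y < x)
  ¬¬-compare x y k = k (inj₂ (inj₁ (proj₁ (tight x y) λ x#y → apart (Equivalence.to (#⇔<⊎> x y) x#y))))
    where
    apart : ¬ (x < y ⊎ y < x)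
    apart (inj₁ x<y) = k (inj₁ x<y)
    apart (inj₂ y<x) = k (inj₂ (inj₂ y<x))

  -- Since `x ≤ y` is a negation, a doubly negated premise may be opened when proving it. This
  -- admits classical case distinctions in proofs of inequalities.
  ≤-bind : ∀ {P : Set} {x y} → ¬ ¬ P → (P → x ≤ y) → x ≤ y
  ≤-bind ¬¬p f y<x = ¬¬p λ p → f p y<x

  <⇒≤ : ∀ {x y} → x < y → x ≤ y
  <⇒≤ = <-asym

  ≈⇒≤ : ∀ {x y} → x ≈ y → x ≤ y
  ≈⇒≤ x≈y = <-irrefl (sym x≈y)

  ≤-refl : ∀ {x} → x ≤ x
  ≤-refl = ≈⇒≤ refl

  ≤⇒¬¬<⊎≈ : ∀ {x y} → x ≤ y → ¬ ¬ (x < y ⊎ x ≈ y)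
  ≤⇒¬¬<⊎≈ {x} {y} x≤y k = ¬¬-compare x y λ where
    (inj₁ x<y)        → k (inj₁ x<y)
    (inj₂ (inj₁ x≈y)) → k (inj₂ x≈y)
    (inj₂ (inj₂ y<x)) → x≤y y<x

  <-≤-trans : ∀ {x y z} → x < y → y ≤ z → x < z
  <-≤-trans {x} {y} {z} x<y y≤z with <-cotrans x<y z
  ... | inj₁ x<z = x<z
  ... | inj₂ z<y = contradiction z<y y≤z

  ≤-<-trans : ∀ {x y z} → x ≤ y → y < z → x < z
  ≤-<-trans {x} {y} {z} x≤y y<z with <-cotrans y<z x
  ... | inj₁ y<x = contradiction y<x x≤y
  ... | inj₂ x<z = x<z

  ≤-trans : ∀ {x y z} → x ≤ y → y ≤ z → x ≤ z
  ≤-trans x≤y y≤z z<x = y≤z (<-≤-trans z<x x≤y)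

  ≤-isPreorder : IsPreorder _≈_ _≤_
  ≤-isPreorder = record { isEquivalence = isEquivalence ; reflexive = ≈⇒≤ ; trans = ≤-trans }

  module ≤-Reasoning where
    open import Relation.Binary.Reasoning.Base.Triple
      ≤-isPreorder <-asym <-trans <-resp-≈ <⇒≤ <-≤-trans ≤-<-trans public

  open ≤-Reasoning

  private
    x+z-z : ∀ x z → (x + z) + - z ≈ x
    x+z-z x z = trans (+-assoc x z (- z)) (trans (+-congˡ (-‿inverseʳ z)) (+-identityʳ x))

  x-y+y : ∀ x y → (x - y) + y ≈ x
  x-y+y x y = trans (+-assoc x (- y) y) (trans (+-congˡ (-‿inverseˡ y)) (+-identityʳ x))

  +-cancelʳ-< : ∀ z {x y} → x + z < y + z → x < y
  +-cancelʳ-< z {x} {y} h = <-respˡ-≈ (x+z-z x z) (<-respʳ-≈ (x+z-z y z) (+-monoˡ-< (- z) h))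

  +-monoʳ-< : ∀ z {x y} → x < y → z + x < z + y
  +-monoʳ-< z {x} {y} h = <-respˡ-≈ (+-comm x z) (<-respʳ-≈ (+-comm y z) (+-monoˡ-< z h))

  +-monoˡ-≤ : ∀ z {x y} → x ≤ y → x + z ≤ y + z
  +-monoˡ-≤ z x≤y = x≤y ∘ +-cancelʳ-< z

  +-monoʳ-≤ : ∀ z {x y} → x ≤ y → z + x ≤ z + y
  +-monoʳ-≤ z {x} {y} h = begin z + x ≈⟨ +-comm z x ⟩ x + z ≤⟨ +-monoˡ-≤ z h ⟩ y + z ≈⟨ +-comm y z ⟩ z + y ∎

  +-mono-≤ : ∀ {x y u v} → x ≤ y → u ≤ v → x + u ≤ y + v
  +-mono-≤ {x} {y} {u} {v} x≤y u≤v = ≤-trans (+-monoˡ-≤ u x≤y) (+-monoʳ-≤ y u≤v)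

  +-cancelʳ-≤ : ∀ z {x y} → x + z ≤ y + z → x ≤ y
  +-cancelʳ-≤ z h y<x = h (+-monoˡ-< z y<x)

  +-cancelʳ-≈ : ∀ z {x y} → x + z ≈ y + z → x ≈ y
  +-cancelʳ-≈ z {x} {y} h = trans (sym (x+z-z x z)) (trans (+-congʳ h) (x+z-z y z))

  x<y⇒0<y-x : ∀ {x y} → x < y → 0# < y - x
  x<y⇒0<y-x {x} h = <-respˡ-≈ (-‿inverseʳ x) (+-monoˡ-< (- x) h)

  x≤x+y : ∀ {x y} → 0# ≤ y → x ≤ x + y
  x≤x+y {x} {y} h = begin x ≈⟨ +-identityʳ x ⟨ x + 0# ≤⟨ +-monoʳ-≤ x h ⟩ x + y ∎

  *-monoʳ-< : ∀ {z x y} → 0# < z → x < y → z * x < z * y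
  *-monoʳ-< {z} {x} {y} 0<z x<y = begin-strict
    z * x                ≈⟨ +-identityˡ _ ⟨
    0# + z * x           <⟨ +-monoˡ-< (z * x) (*-pos 0<z (x<y⇒0<y-x x<y)) ⟩
    z * (y - x) + z * x  ≈⟨ distribˡ z (y - x) x ⟨
    z * ((y - x) + x)    ≈⟨ *-congˡ (x-y+y y x) ⟩
    z * y                ∎

  *-monoˡ-< : ∀ {z x y} → 0# < z → x < y → x * z < y * z
  *-monoˡ-< {z} {x} {y} 0<z x<y = <-respˡ-≈ (*-comm z x) (<-respʳ-≈ (*-comm z y) (*-monoʳ-< 0<z x<y))

  *-monoʳ-≤ : ∀ {z x y} → 0# ≤ z → x ≤ y → z * x ≤ z * y
  *-monoʳ-≤ {z} {x} {y} 0≤z x≤y = ≤-bind (≤⇒¬¬<⊎≈ 0≤z) λ where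
    (inj₁ 0<z) → ≤-bind (≤⇒¬¬<⊎≈ x≤y) λ where
      (inj₁ x<y) → <⇒≤ (*-monoʳ-< 0<z x<y)
      (inj₂ x≈y) → ≈⇒≤ (*-congˡ x≈y)
    (inj₂ 0≈z) → ≈⇒≤ (trans (*-congʳ (sym 0≈z)) (trans (trans (zeroˡ x) (sym (zeroˡ y))) (*-congʳ 0≈z)))

  *-monoˡ-≤ : ∀ {z x y} → 0# ≤ z → x ≤ y → x * z ≤ y * z
  *-monoˡ-≤ {z} {x} {y} 0≤z x≤y = begin x * z ≈⟨ *-comm x z ⟩ z * x ≤⟨ *-monoʳ-≤ 0≤z x≤y ⟩ z * y ≈⟨ *-comm z y ⟩ y * z ∎

  *-mono-≤ : ∀ {x y u v} → 0# ≤ y → 0# ≤ u → x ≤ y → u ≤ v → x * u ≤ y * v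
  *-mono-≤ 0≤y 0≤u x≤y u≤v = ≤-trans (*-monoˡ-≤ 0≤u x≤y) (*-monoʳ-≤ 0≤y u≤v)

  *-nonneg : ∀ {x y} → 0# ≤ x → 0# ≤ y → 0# ≤ x * y
  *-nonneg {x} {y} 0≤x 0≤y = begin 0# ≈⟨ zeroʳ x ⟨ x * 0# ≤⟨ *-monoʳ-≤ 0≤x 0≤y ⟩ x * y ∎

  +-nonneg : ∀ {x y} → 0# ≤ x → 0# ≤ y → 0# ≤ x + y
  +-nonneg 0≤x 0≤y = ≤-trans 0≤x (x≤x+y 0≤y)

  *-cancelˡ-≤ : ∀ {z x y} → 0# < z → z * x ≤ z * y → x ≤ y
  *-cancelˡ-≤ 0<z h y<x = h (*-monoʳ-< 0<z y<x)

  *-cancelʳ-≤ : ∀ {z x y} → 0# < z → x * z ≤ y * z → x ≤ y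
  *-cancelʳ-≤ 0<z h y<x = h (*-monoˡ-< 0<z y<x)

  ^-pos : ∀ {x} n → 0# < x → 0# < x ^ n
  ^-pos zero    0<x = 0<1
  ^-pos (suc n) 0<x = *-pos 0<x (^-pos n 0<x)

  ^-nonneg : ∀ {x} n → 0# ≤ x → 0# ≤ x ^ n
  ^-nonneg zero    0≤x = <⇒≤ 0<1
  ^-nonneg (suc n) 0≤x = *-nonneg 0≤x (^-nonneg n 0≤x)

  ^-monoˡ-≤ : ∀ {x y} n → 0# ≤ x → x ≤ y → x ^ n ≤ y ^ n
  ^-monoˡ-≤ zero    0≤x x≤y = ≤-refl
  ^-monoˡ-≤ (suc n) 0≤x x≤y = *-mono-≤ (≤-trans 0≤x x≤y) (^-nonneg n 0≤x) x≤y (^-monoˡ-≤ n 0≤x x≤y)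

  1≤^ : ∀ {x} n → 1# ≤ x → 1# ≤ x ^ n
  1≤^ zero    1≤x = ≤-refl
  1≤^ {x} (suc n) 1≤x = begin
    1#       ≈⟨ *-identityˡ 1# ⟨
    1# * 1#  ≤⟨ *-mono-≤ (≤-trans (<⇒≤ 0<1) 1≤x) (<⇒≤ 0<1) 1≤x (1≤^ n 1≤x) ⟩
    x * x ^ n ∎

  ^≤1 : ∀ {x} n → 0# ≤ x → x ≤ 1# → x ^ n ≤ 1#
  ^≤1 zero    0≤x x≤1 = ≤-refl
  ^≤1 {x} (suc n) 0≤x x≤1 = begin
    x * x ^ n ≤⟨ *-mono-≤ (<⇒≤ 0<1) (^-nonneg n 0≤x) x≤1 (^≤1 n 0≤x x≤1) ⟩
    1# * 1#   ≈⟨ *-identityˡ 1# ⟩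
    1#        ∎

  x<1+x : ∀ x → x < 1# + x
  x<1+x x = <-respˡ-≈ (+-identityˡ x) (+-monoˡ-< x 0<1)

  0≤fromℕ : ∀ m → 0# ≤ fromℕ m
  0≤fromℕ zero    = ≤-refl
  0≤fromℕ (suc m) = +-nonneg (<⇒≤ 0<1) (0≤fromℕ m)

  fromℕ-mono-≤ : ∀ {m n} → m ℕ.≤ n → fromℕ m ≤ fromℕ n
  fromℕ-mono-≤ {n = n} ℕ.z≤n = 0≤fromℕ n
  fromℕ-mono-≤ (ℕ.s≤s m≤n) = +-monoʳ-≤ 1# (fromℕ-mono-≤ m≤n)

  fromℕ-mono-< : ∀ {m n} → m ℕ.< n → fromℕ m < fromℕ n
  fromℕ-mono-< {m} {n} m<n = <-≤-trans (x<1+x (fromℕ m)) (fromℕ-mono-≤ m<n)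

  fromℕ-+ : ∀ m n → fromℕ (m ℕ.+ n) ≈ fromℕ m + fromℕ n
  fromℕ-+ = ·-homo-+ 1#

  fromℕ-* : ∀ m n → fromℕ (m ℕ.* n) ≈ fromℕ m * fromℕ n
  fromℕ-* = ·1-homo-*

  fromℕ-cancel-≤ : ∀ {m n} → fromℕ m ≤ fromℕ n → m ℕ.≤ n
  fromℕ-cancel-≤ {m} {n} h = ℕ.≮⇒≥ λ n<m → h (fromℕ-mono-< n<m)

  x-0≈x : ∀ x → x - 0# ≈ x
  x-0≈x x = trans (sym (+-identityʳ _)) (x-y+y x 0#)

  -- A real need not have a decidable sign, but an inverse makes it apart from zero, and apartness
  -- means one of the two strict comparisons.
  invertible⇒≶0 : ∀ {x} y → x * y ≈ 1# → x < 0# ⊎ 0# < x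
  invertible⇒≶0 {x} y xy≈1 = Equivalence.to (#⇔<⊎> x 0#)
    (invertible⇒# (y , trans (*-comm _ _) inverse , inverse))
    where
    inverse : (x - 0#) * y ≈ 1#
    inverse = trans (*-congʳ (x-0≈x x)) xy≈1

  pos⇒invertible : ∀ {x} → 0# < x → ∃[ y ] x * y ≈ 1#
  pos⇒invertible {x} 0<x with #⇒invertible {x} {0#} (#-sym (Equivalence.from (#⇔<⊎> 0# x) (inj₁ 0<x)))
  ... | y , _ , xy≈1 = y , trans (*-congʳ (sym (x-0≈x x))) xy≈1

  -- A positive product is invertible, so its factor `y` is invertible too and has a sign; the
  -- negative sign is impossible. Positivity of reciprocals and of the speed bound comes from here.
  *-pos⁻¹ : ∀ {x y} → 0# ≤ x → 0# < x * y → 0# < y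
  *-pos⁻¹ {x} {y} 0≤x 0<xy with pos⇒invertible 0<xy
  ... | z , xyz≈1 with invertible⇒≶0 {y} (x * z)
                         (trans (solve 3 (λ x y z → y :* (x :* z) := x :* y :* z) refl x y z) xyz≈1)
  ...   | inj₂ 0<y = 0<y
  ...   | inj₁ y<0 = contradiction 0<xy (≤-trans (*-monoʳ-≤ 0≤x (<⇒≤ y<0)) (≈⇒≤ (zeroʳ x)))

  archimedean-* : ∀ {x} y → 0# < x → ∃[ k ] y < fromℕ k * x
  archimedean-* {x} y 0<x with pos⇒invertible 0<x
  ... | x⁻¹ , xx⁻¹≈1 with archimedean (y * x⁻¹)
  ...   | k , yx⁻¹<k = k , (begin-strict
    y              ≈⟨ *-identityʳ y ⟨
    y * 1#         ≈⟨ *-congˡ xx⁻¹≈1 ⟨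
    y * (x * x⁻¹)  ≈⟨ solve 3 (λ y x z → y :* (x :* z) := y :* z :* x) refl y x x⁻¹ ⟩
    y * x⁻¹ * x    <⟨ *-monoˡ-< 0<x yx⁻¹<k ⟩
    fromℕ k * x    ∎)

  open RealFunctions R

  recipℕ-inverse : ∀ m .{{_ : NonZero m}} → fromℕ m * recipℕ m ≈ 1#
  recipℕ-inverse m = trans (*-congʳ (sym (x-0≈x (fromℕ m))))
    (proj₂ (proj₂ (#⇒invertible (fromℕ#0 m))))

  /ℕ-cancel : ∀ x m .{{_ : NonZero m}} → fromℕ m * (x /ℕ m) ≈ x
  /ℕ-cancel x m = begin-equality
    fromℕ m * (x * recipℕ m) ≈⟨ solve 3 (λ a b c → a :* (b :* c) := b :* (a :* c)) refl (fromℕ m) x (recipℕ m) ⟩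
    x * (fromℕ m * recipℕ m) ≈⟨ *-congˡ (recipℕ-inverse m) ⟩
    x * 1#                   ≈⟨ *-identityʳ x ⟩
    x                        ∎

  0<fromℕ : ∀ m .{{_ : NonZero m}} → 0# < fromℕ m
  0<fromℕ (suc m) = 0<fromℕ-suc m

  0<recipℕ : ∀ m .{{_ : NonZero m}} → 0# < recipℕ m
  0<recipℕ m = *-pos⁻¹ (0≤fromℕ m) (<-respʳ-≈ (sym (recipℕ-inverse m)) 0<1)

  0≤recipℕ : ∀ m .{{_ : NonZero m}} → 0# ≤ recipℕ m
  0≤recipℕ m = <⇒≤ (0<recipℕ m)

-- Estimates for the exponential function on truncated series

module ExponentialSeries (R : Reals) where

  open Reals R hiding (zero)
  open RealFunctions R
  open OrderedFieldProperties R
  open ≤-Reasoning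

  -- Mean value estimate for powers, with the derivative taken at the right end of the interval;
  -- `x+a-pow-lower` takes it at the left end.
  x+b-pow-upper : ∀ {x b} k → 0# ≤ x → 0# ≤ b →
    (x + b) ^ suc k ≤ x ^ suc k + fromℕ (suc k) * b * (x + b) ^ k
  x+b-pow-upper {x} {b} zero 0≤x 0≤b = ≈⇒≤
    (solve 2 (λ x b → (x :+ b) :* con 1 := x :* con 1 :+ (con 1 :+ con 0) :* b :* con 1) refl x b)
  x+b-pow-upper {x} {b} (suc k) 0≤x 0≤b = begin
    (x + b) * (x + b) ^ suc k
      ≈⟨ distribʳ _ x b ⟩
    x * (x + b) ^ suc k + b * (x + b) ^ suc k
      ≤⟨ +-monoˡ-≤ _ (*-monoʳ-≤ 0≤x (x+b-pow-upper k 0≤x 0≤b)) ⟩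
    x * (x ^ suc k + fromℕ (suc k) * b * (x + b) ^ k) + b * (x + b) ^ suc k
      ≈⟨ solve 6 (λ x p n b q s → x :* (p :+ n :* b :* q) :+ b :* s := x :* p :+ (n :* b :* (x :* q) :+ b :* s))
           refl x (x ^ suc k) (fromℕ (suc k)) b ((x + b) ^ k) ((x + b) ^ suc k) ⟩
    x ^ suc (suc k) + (fromℕ (suc k) * b * (x * (x + b) ^ k) + b * (x + b) ^ suc k)
      ≤⟨ +-monoʳ-≤ _ (+-monoˡ-≤ _ (*-monoʳ-≤ (*-nonneg (0≤fromℕ (suc k)) 0≤b)
           (*-monoˡ-≤ (^-nonneg k (+-nonneg 0≤x 0≤b)) (x≤x+y 0≤b)))) ⟩
    x ^ suc (suc k) + (fromℕ (suc k) * b * (x + b) ^ suc k + b * (x + b) ^ suc k)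
      ≈⟨ solve 4 (λ p n b s → p :+ (n :* b :* s :+ b :* s) := p :+ (con 1 :+ n) :* b :* s)
           refl (x ^ suc (suc k)) (fromℕ (suc k)) b ((x + b) ^ suc k) ⟩
    x ^ suc (suc k) + fromℕ (suc (suc k)) * b * (x + b) ^ suc k ∎

  x+a-pow-lower : ∀ {x a} k → 0# ≤ x → 0# ≤ a →
    x ^ suc k + fromℕ (suc k) * a * x ^ k ≤ (x + a) ^ suc k
  x+a-pow-lower {x} {a} zero 0≤x 0≤a = ≈⇒≤
    (solve 2 (λ x b → x :* con 1 :+ (con 1 :+ con 0) :* b :* con 1 := (x :+ b) :* con 1) refl x a)
  x+a-pow-lower {x} {a} (suc k) 0≤x 0≤a = begin
    x ^ suc (suc k) + fromℕ (suc (suc k)) * a * x ^ suc k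
      ≤⟨ x≤x+y (*-nonneg (*-nonneg (0≤fromℕ (suc k)) (*-nonneg 0≤a 0≤a)) (^-nonneg k 0≤x)) ⟩
    x ^ suc (suc k) + fromℕ (suc (suc k)) * a * x ^ suc k + fromℕ (suc k) * (a * a) * x ^ k
      ≈⟨ solve 4 (λ x p n a → x :* (x :* p) :+ (con 1 :+ n) :* a :* (x :* p) :+ n :* (a :* a) :* p
                           := (x :+ a) :* (x :* p :+ n :* a :* p))
           refl x (x ^ k) (fromℕ (suc k)) a ⟩
    (x + a) * (x ^ suc k + fromℕ (suc k) * a * x ^ k)
      ≤⟨ *-monoʳ-≤ (+-nonneg 0≤x 0≤a) (x+a-pow-lower k 0≤x 0≤a) ⟩
    (x + a) * (x + a) ^ suc k ∎

  partialSum-mono : ∀ {f g} K → (∀ k → f k ≤ g k) → partialSum f K ≤ partialSum g K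
  partialSum-mono zero    f≤g = ≤-refl
  partialSum-mono (suc K) f≤g = +-mono-≤ (f≤g 0) (partialSum-mono K (λ k → f≤g (suc k)))

  partialSum-linear : ∀ f g b K →
    partialSum (λ k → f k + b * g k) K ≈ partialSum f K + b * partialSum g K
  partialSum-linear f g b zero = solve 1 (λ b → con 0 := con 0 :+ b :* con 0) refl b
  partialSum-linear f g b (suc K) = trans
    (+-congˡ (partialSum-linear (λ k → f (suc k)) (λ k → g (suc k)) b K))
    (solve 5 (λ f g b F G → f :+ b :* g :+ (F :+ b :* G) := f :+ F :+ b :* (g :+ G)) refl
      (f 0) (g 0) b (partialSum (λ k → f (suc k)) K) (partialSum (λ k → g (suc k)) K))

  partialSum-≤-suc : ∀ {f} K → (∀ k → 0# ≤ f k) → partialSum f K ≤ partialSum f (suc K)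
  partialSum-≤-suc zero    0≤f = +-nonneg (0≤f 0) ≤-refl
  partialSum-≤-suc (suc K) 0≤f = +-monoʳ-≤ _ (partialSum-≤-suc K (λ k → 0≤f (suc k)))

  term : ℝ → ℕ → ℝ
  term x k = (x ^ k) / k !

  expSum : ℝ → ℕ → ℝ
  expSum x = partialSum (term x)

  1/_! : ℕ → ℝ
  1/ k ! = recipℕ (k !) {{k ℕ.!≢0}}

  0≤1/! : ∀ k → 0# ≤ 1/ k !
  0≤1/! k = 0≤recipℕ (k !) {{k ℕ.!≢0}}

  1/suc! : ∀ k → fromℕ (suc k) * 1/ suc k ! ≈ 1/ k !
  1/suc! k = begin-equality
    fromℕ (suc k) * 1/ suc k !
      ≈⟨ *-identityʳ _ ⟨
    fromℕ (suc k) * 1/ suc k ! * 1#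
      ≈⟨ *-congˡ (recipℕ-inverse (k !) {{k ℕ.!≢0}}) ⟨
    fromℕ (suc k) * 1/ suc k ! * (fromℕ (k !) * 1/ k !)
      ≈⟨ solve 4 (λ n r f s → n :* r :* (f :* s) := n :* f :* r :* s) refl
           (fromℕ (suc k)) (1/ suc k !) (fromℕ (k !)) (1/ k !) ⟩
    fromℕ (suc k) * fromℕ (k !) * 1/ suc k ! * 1/ k !
      ≈⟨ *-congʳ (*-congʳ (fromℕ-* (suc k) (k !))) ⟨
    fromℕ (suc k !) * 1/ suc k ! * 1/ k !
      ≈⟨ *-congʳ (recipℕ-inverse (suc k !) {{suc k ℕ.!≢0}}) ⟩
    1# * 1/ k !
      ≈⟨ *-identityˡ _ ⟩
    1/ k ! ∎

  term-nonneg : ∀ {x} k → 0# ≤ x → 0# ≤ term x k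
  term-nonneg k 0≤x = *-nonneg (^-nonneg k 0≤x) (0≤1/! k)

  private
    -- The factor k + 1 of the derivative cancels against (k + 1)!. This is exp′ = exp at the level
    -- of single terms.
    derivative : ∀ p b q k →
      (p + fromℕ (suc k) * b * q) * 1/ suc k ! ≈ p * 1/ suc k ! + b * (q * 1/ k !)
    derivative p b q k = begin-equality
      (p + fromℕ (suc k) * b * q) * 1/ suc k !
        ≈⟨ solve 5 (λ p n b q r → (p :+ n :* b :* q) :* r := p :* r :+ b :* (q :* (n :* r))) refl
             p (fromℕ (suc k)) b q (1/ suc k !) ⟩
      p * 1/ suc k ! + b * (q * (fromℕ (suc k) * 1/ suc k !))
        ≈⟨ +-congˡ (*-congˡ (*-congˡ (1/suc! k))) ⟩
      p * 1/ suc k ! + b * (q * 1/ k !) ∎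

  term-upper : ∀ {x b} k → 0# ≤ x → 0# ≤ b →
    term (x + b) (suc k) ≤ term x (suc k) + b * term (x + b) k
  term-upper {x} {b} k 0≤x 0≤b = ≤-trans
    (*-monoˡ-≤ (0≤1/! (suc k)) (x+b-pow-upper k 0≤x 0≤b))
    (≈⇒≤ (derivative (x ^ suc k) b ((x + b) ^ k) k))

  term-lower : ∀ {x a} k → 0# ≤ x → 0# ≤ a →
    term x (suc k) + a * term x k ≤ term (x + a) (suc k)
  term-lower {x} {a} k 0≤x 0≤a = ≤-trans
    (≈⇒≤ (sym (derivative (x ^ suc k) a (x ^ k) k)))
    (*-monoˡ-≤ (0≤1/! (suc k)) (x+a-pow-lower k 0≤x 0≤a))

  expSum-mono : ∀ {x y} K → 0# ≤ x → x ≤ y → expSum x K ≤ expSum y K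
  expSum-mono K 0≤x x≤y = partialSum-mono K λ k → *-monoˡ-≤ (0≤1/! k) (^-monoˡ-≤ k 0≤x x≤y)

  expSum-nonneg : ∀ {x} K → 0# ≤ x → 0# ≤ expSum x K
  expSum-nonneg zero    0≤x = ≤-refl
  expSum-nonneg (suc K) 0≤x = ≤-trans (expSum-nonneg K 0≤x) (partialSum-≤-suc K λ k → term-nonneg k 0≤x)

  -- Sum of the term estimates. The index shift leaves a sum that is one term shorter on the right,
  -- and the missing term is nonnegative.
  expSum-upper : ∀ {x b} K → 0# ≤ x → 0# ≤ b → expSum (x + b) K ≤ expSum x K + b * expSum (x + b) K
  expSum-upper {x} {b} zero 0≤x 0≤b = ≈⇒≤ (solve 1 (λ b → con 0 := con 0 :+ b :* con 0) refl b)
  expSum-upper {x} {b} (suc K) 0≤x 0≤b = begin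
    term x 0 + partialSum (λ k → term (x + b) (suc k)) K
      ≤⟨ +-monoʳ-≤ _ (partialSum-mono K λ k → term-upper k 0≤x 0≤b) ⟩
    term x 0 + partialSum (λ k → term x (suc k) + b * term (x + b) k) K
      ≈⟨ +-congˡ (partialSum-linear (λ k → term x (suc k)) (term (x + b)) b K) ⟩
    term x 0 + (partialSum (λ k → term x (suc k)) K + b * expSum (x + b) K)
      ≈⟨ +-assoc _ _ _ ⟨
    expSum x (suc K) + b * expSum (x + b) K
      ≤⟨ +-monoʳ-≤ _ (*-monoʳ-≤ 0≤b (partialSum-≤-suc K λ k → term-nonneg k (+-nonneg 0≤x 0≤b))) ⟩
    expSum x (suc K) + b * expSum (x + b) (suc K) ∎

  -- Truncated form of (1 + a) exp(x) ≤ exp(x + a). The right side needs one more term, because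
  -- `a * term x k` contributes to degree k + 1.
  expSum-lower : ∀ {x a} K → 0# ≤ x → 0# ≤ a → (1# + a) * expSum x K ≤ expSum (x + a) (suc K)
  expSum-lower {x} {a} K 0≤x 0≤a = begin
    (1# + a) * expSum x K
      ≈⟨ solve 2 (λ a s → (con 1 :+ a) :* s := s :+ a :* s) refl a (expSum x K) ⟩
    expSum x K + a * expSum x K
      ≤⟨ +-monoˡ-≤ _ (partialSum-≤-suc K λ k → term-nonneg k 0≤x) ⟩
    (term x 0 + partialSum (λ k → term x (suc k)) K) + a * expSum x K
      ≈⟨ +-assoc _ _ _ ⟩
    term x 0 + (partialSum (λ k → term x (suc k)) K + a * expSum x K)
      ≈⟨ +-congˡ (partialSum-linear (λ k → term x (suc k)) (term x) a K) ⟨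
    term x 0 + partialSum (λ k → term x (suc k) + a * term x k) K
      ≤⟨ +-monoʳ-≤ _ (partialSum-mono K λ k → term-lower k 0≤x 0≤a) ⟩
    expSum (x + a) (suc K) ∎

  -- Rearranging `expSum-upper` with e = 1 - b gives the truncated form of exp(b) (1 - b) ≤ 1,
  -- applied at the point x.
  expSum-contract : ∀ {x b e} K → 0# ≤ x → 0# ≤ b → e + b ≈ 1# → expSum (x + b) K * e ≤ expSum x K
  expSum-contract {x} {b} {e} K 0≤x 0≤b e+b≈1 = +-cancelʳ-≤ (b * S) (begin
    S * e + b * S       ≈⟨ solve 3 (λ s e b → s :* e :+ b :* s := s :* (e :+ b)) refl S e b ⟩
    S * (e + b)         ≈⟨ *-congˡ e+b≈1 ⟩
    S * 1#              ≈⟨ *-identityʳ S ⟩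
    S                   ≤⟨ expSum-upper K 0≤x 0≤b ⟩
    expSum x K + b * S  ∎)
    where S = expSum (x + b) K

  expSum-0 : ∀ K → expSum 0# K ≤ 1#
  expSum-0 zero    = <⇒≤ 0<1
  expSum-0 (suc K) = begin
    term 0# 0 + partialSum (λ k → term 0# (suc k)) K
      ≤⟨ +-mono-≤ (≈⇒≤ (trans (*-congʳ (sym (+-identityʳ 1#))) (recipℕ-inverse 1)))
                  (≤-trans (partialSum-mono {f = λ k → term 0# (suc k)} {g = λ _ → 0#} K
                            λ k → ≈⇒≤ (trans (*-congʳ (zeroˡ _)) (zeroˡ _)))
                           (≈⇒≤ (zeros K))) ⟩
    1# + 0#
      ≈⟨ +-identityʳ 1# ⟩
    1# ∎
    where
    zeros : ∀ K → partialSum (λ _ → 0#) K ≈ 0#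
    zeros zero    = refl
    zeros (suc K) = trans (+-identityˡ _) (zeros K)

  expSum-*-bound : ∀ {b e} M K → 0# ≤ b → 0# ≤ e → e + b ≈ 1# → expSum (fromℕ M * b) K * e ^ M ≤ 1#
  expSum-*-bound {b} zero K 0≤b 0≤e e+b≈1 = begin
    expSum (0# * b) K * 1#  ≈⟨ *-identityʳ _ ⟩
    expSum (0# * b) K       ≤⟨ expSum-mono K (≈⇒≤ (sym (zeroˡ b))) (≈⇒≤ (zeroˡ b)) ⟩
    expSum 0# K             ≤⟨ expSum-0 K ⟩
    1#                      ∎
  expSum-*-bound {b} {e} (suc M) K 0≤b 0≤e e+b≈1 = begin
    expSum (fromℕ (suc M) * b) K * (e * e ^ M)
      ≈⟨ *-assoc _ _ _ ⟨
    expSum (fromℕ (suc M) * b) K * e * e ^ M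
      ≤⟨ *-monoˡ-≤ (^-nonneg M 0≤e) (*-monoˡ-≤ 0≤e (expSum-mono K (*-nonneg (0≤fromℕ (suc M)) 0≤b)
           (≈⇒≤ (solve 2 (λ m b → (con 1 :+ m) :* b := m :* b :+ b) refl (fromℕ M) b)))) ⟩
    expSum (fromℕ M * b + b) K * e * e ^ M
      ≤⟨ *-monoˡ-≤ (^-nonneg M 0≤e) (expSum-contract K (*-nonneg (0≤fromℕ M) 0≤b) 0≤b e+b≈1) ⟩
    expSum (fromℕ M * b) K * e ^ M
      ≤⟨ expSum-*-bound M K 0≤b 0≤e e+b≈1 ⟩
    1# ∎

  expSum-bound : ∀ {x b e} M K → 0# ≤ x → x ≤ fromℕ M * b → 0# ≤ b → 0# ≤ e → e + b ≈ 1# →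
    expSum x K * e ^ M ≤ 1#
  expSum-bound M K 0≤x x≤Mb 0≤b 0≤e e+b≈1 = ≤-trans
    (*-monoˡ-≤ (^-nonneg M 0≤e) (expSum-mono K 0≤x x≤Mb)) (expSum-*-bound M K 0≤b 0≤e e+b≈1)

  [1+a]^N≤expSum : ∀ {a} N → 0# ≤ a → (1# + a) ^ N ≤ expSum (fromℕ N * a) (suc N)
  [1+a]^N≤expSum {a} zero 0≤a = ≈⇒≤ (sym (trans (+-identityʳ _)
    (trans (*-congʳ (sym (+-identityʳ 1#))) (recipℕ-inverse 1))))
  [1+a]^N≤expSum {a} (suc N) 0≤a = begin
    (1# + a) * (1# + a) ^ N
      ≤⟨ *-monoʳ-≤ (+-nonneg (<⇒≤ 0<1) 0≤a) ([1+a]^N≤expSum N 0≤a) ⟩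
    (1# + a) * expSum (fromℕ N * a) (suc N)
      ≤⟨ expSum-lower (suc N) (*-nonneg (0≤fromℕ N) 0≤a) 0≤a ⟩
    expSum (fromℕ N * a + a) (suc (suc N))
      ≤⟨ expSum-mono (suc (suc N)) (+-nonneg (*-nonneg (0≤fromℕ N) 0≤a) 0≤a)
           (≈⇒≤ (solve 2 (λ m b → m :* b :+ b := (con 1 :+ m) :* b) refl (fromℕ N) a)) ⟩
    expSum (fromℕ (suc N) * a) (suc (suc N)) ∎

  -- The truncated series stands between the two powers: (1 + a)^N is at most its value at N a,
  -- hence at M b, and that value times (1 - b)^M is at most 1.
  [1+a]^N*[1-b]^M≤1 : ∀ {a b e} N M → 0# ≤ a → 0# ≤ b → 0# ≤ e → e + b ≈ 1# →
    fromℕ N * a ≤ fromℕ M * b → (1# + a) ^ N * e ^ M ≤ 1#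
  [1+a]^N*[1-b]^M≤1 N M 0≤a 0≤b 0≤e e+b≈1 Na≤Mb = ≤-trans
    (*-monoˡ-≤ (^-nonneg M 0≤e) ([1+a]^N≤expSum N 0≤a))
    (expSum-bound M (suc N) (*-nonneg (0≤fromℕ N) 0≤a) Na≤Mb 0≤b 0≤e e+b≈1)

  ≤1-by-archimedean : ∀ {z} → (∀ k → fromℕ k * z ≤ 1# + fromℕ k) → z ≤ 1#
  ≤1-by-archimedean {z} h 1<z with archimedean-* 1# (x<y⇒0<y-x 1<z)
  ... | k , 1<k[z-1] = h k (begin-strict
    1# + fromℕ k                  <⟨ +-monoˡ-< (fromℕ k) 1<k[z-1] ⟩
    fromℕ k * (z - 1#) + fromℕ k  ≈⟨ +-congˡ (*-identityʳ _) ⟨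
    fromℕ k * (z - 1#) + fromℕ k * 1#  ≈⟨ distribˡ _ _ _ ⟨
    fromℕ k * (z - 1# + 1#)       ≈⟨ *-congˡ (x-y+y z 1#) ⟩
    fromℕ k * z                   ∎)

  -- The factor E ≤ 1 does not enlarge the convergence error, so k y E exceeds k by at most 1 for
  -- every k; the Archimedean property removes this error.
  limit-*-bound : ∀ {f y E} → Converges f y → 0# ≤ E → E ≤ 1# → (∀ i → f i * E ≤ 1#) → y * E ≤ 1#
  limit-*-bound {f} {y} {E} f→y 0≤E E≤1 fE≤1 = ≤1-by-archimedean λ k →
    let i , close = f→y k in begin
    fromℕ k * (y * E)
      ≈⟨ *-congˡ (*-congʳ (x-y+y y (f i))) ⟨
    fromℕ k * ((y - f i + f i) * E)
      ≈⟨ solve 4 (λ k d f e → k :* ((d :+ f) :* e) := k :* d :* e :+ k :* (f :* e)) refl (fromℕ k) (y - f i) (f i) E ⟩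
    fromℕ k * (y - f i) * E + fromℕ k * (f i * E)
      ≤⟨ +-mono-≤ (*-monoˡ-≤ 0≤E (<⇒≤ (proj₂ (close i ℕ.≤-refl)))) (*-monoʳ-≤ (0≤fromℕ k) (fE≤1 i)) ⟩
    1# * E + fromℕ k * 1#
      ≤⟨ +-mono-≤ (≤-trans (≈⇒≤ (*-identityˡ E)) E≤1) (≈⇒≤ (*-identityʳ _)) ⟩
    1# + fromℕ k ∎

  e≤1 : ∀ {b e} → 0# ≤ b → e + b ≈ 1# → e ≤ 1#
  e≤1 0≤b e+b≈1 = ≤-trans (x≤x+y 0≤b) (≈⇒≤ e+b≈1)

  -- This is how the logarithm enters: for y = n/2 and x = ln(n/2) it says that M independent nodes,
  -- each transmitting with probability b ≥ x/M, are all silent with probability at most 2/n.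
  exp-bound : ∀ {x y b e} M → IsExp x y → 0# ≤ x → x ≤ fromℕ M * b → 0# ≤ b → 0# ≤ e → e + b ≈ 1# →
    y * e ^ M ≤ 1#
  exp-bound M x↦y 0≤x x≤Mb 0≤b 0≤e e+b≈1 = limit-*-bound x↦y (^-nonneg M 0≤e)
    (^≤1 M 0≤e (e≤1 0≤b e+b≈1)) λ K → expSum-bound M K 0≤x x≤Mb 0≤b 0≤e e+b≈1

-- Choice of the thresholds, and the numerical end of the argument

module HitRates (R : Reals) where

  open Reals R hiding (zero)
  open RealFunctions R
  open OrderedFieldProperties R
  open ExponentialSeries R
  open ≤-Reasoning

  -- If all informed nodes transmit with probability p < c, then a lone informed
  -- neighbour rarely transmits; if p > c′, then it is unlikely that one of two
  -- given groups of M informed nodes is silent.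
  record Threshold (M : ℕ) : Set where
    field
      c′ c  : ℝ
      c′<c  : c′ < c
      0≤c   : 0# ≤ c
      crowd : ∀ {p e} → c′ < p → 0# ≤ e → e + p ≈ 1# → e ^ M + e ^ M ≤ c

    growth : ℝ
    growth = 1# + fromℕ 3 * c

  ^-distrib : ∀ x y n → x ^ n * y ^ n ≈ (x * y) ^ n
  ^-distrib x y n = sym (^-distrib-* x y n)

  ^-mono-< : ∀ {x y} n .{{_ : NonZero n}} → 0# < x → x < y → x ^ n < y ^ n
  ^-mono-< {x} {y} (suc n) 0<x x<y = <-≤-trans (*-monoˡ-< (^-pos n 0<x) x<y)
    (*-monoʳ-≤ (<⇒≤ (<-trans 0<x x<y)) (^-monoˡ-≤ n (<⇒≤ 0<x) (<⇒≤ x<y)))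

  module _ (n : ℕ) .{{_ : NonZero n}} (4<n : 4 ℕ.< n) {ℓ q : ℝ} (ln : IsLn (fromℕ n /ℕ 2) ℓ)
           (qℓ : q * (fromℕ 96 * ℓ) ≈ fromℕ (n ℕ.^ 2)) where

    private
      F½ : ℝ
      F½ = fromℕ n /ℕ 2

      2*F½ : fromℕ 2 * F½ ≈ fromℕ n
      2*F½ = /ℕ-cancel (fromℕ n) 2

      n² : fromℕ (n ℕ.^ 2) ≈ fromℕ n * fromℕ n
      n² = trans (fromℕ-* n (n ℕ.* 1)) (*-congˡ (trans (fromℕ-* n 1) (trans (*-congˡ (+-identityʳ 1#)) (*-identityʳ _))))

      0<n : 0# < fromℕ n
      0<n = 0<fromℕ n

      0<n² : 0# < fromℕ (n ℕ.^ 2)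
      0<n² = <-respʳ-≈ (sym n²) (*-pos 0<n 0<n)

      ½+½ : recipℕ 2 + recipℕ 2 ≈ 1#
      ½+½ = trans (solve 1 (λ r → r :+ r := (con 1 :+ (con 1 :+ con 0)) :* r) refl (recipℕ 2)) (recipℕ-inverse 2)

    -- The equation for `q` makes ℓ a divisor of the invertible number n², which gives ℓ a sign
    -- without an analysis of the series. The negative sign is eliminated in `threshold-rate`.
    ℓ-sign : ℓ < 0# ⊎ 0# < ℓ
    ℓ-sign = invertible⇒≶0 (q * fromℕ 96 * (ν * ν)) (begin-equality
      ℓ * (q * fromℕ 96 * (ν * ν))
        ≈⟨ solve 4 (λ q f v l → l :* (q :* f :* (v :* v)) := q :* (f :* l) :* (v :* v)) refl q (fromℕ 96) ν ℓ ⟩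
      q * (fromℕ 96 * ℓ) * (ν * ν)
        ≈⟨ *-congʳ (trans qℓ n²) ⟩
      fromℕ n * fromℕ n * (ν * ν)
        ≈⟨ solve 2 (λ f v → f :* f :* (v :* v) := f :* v :* (f :* v)) refl (fromℕ n) ν ⟩
      fromℕ n * ν * (fromℕ n * ν)
        ≈⟨ *-cong (recipℕ-inverse n) (recipℕ-inverse n) ⟩
      1# * 1#
        ≈⟨ *-identityˡ 1# ⟩
      1# ∎)
      where ν = recipℕ n

    -- If ln(n/2) were below 1/2, then `exp-bound` with a single factor 1 - 1/2 would give n/2 · 1/2
    -- ≤ 1, that is n ≤ 4.
    4≤8ℓ : 0# < ℓ → fromℕ 4 ≤ fromℕ 8 * ℓ
    4≤8ℓ 0<ℓ 8ℓ<4 = ℕ.<⇒≱ 4<n (fromℕ-cancel-≤ (begin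
      fromℕ n                        ≈⟨ 2*F½ ⟨
      fromℕ 2 * F½                   ≈⟨ *-identityʳ _ ⟨
      fromℕ 2 * F½ * 1#              ≈⟨ *-congˡ (recipℕ-inverse 2) ⟨
      fromℕ 2 * F½ * (fromℕ 2 * ½)   ≈⟨ solve 3 (λ f r t → t :* f :* (t :* r) := t :* t :* (f :* (r :* con 1))) refl F½ ½ (fromℕ 2) ⟩
      fromℕ 2 * fromℕ 2 * (F½ * ½ ^ 1)
        ≤⟨ *-monoʳ-≤ (*-nonneg (0≤fromℕ 2) (0≤fromℕ 2)) (exp-bound 1 ln (<⇒≤ 0<ℓ) ℓ≤½ (0≤recipℕ 2) (0≤recipℕ 2) ½+½) ⟩
      fromℕ 2 * fromℕ 2 * 1#         ≈⟨ *-identityʳ _ ⟩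
      fromℕ 2 * fromℕ 2              ≈⟨ fromℕ-* 2 2 ⟨
      fromℕ 4                        ∎))
      where
      ½ = recipℕ 2
      ℓ≤½ : ℓ ≤ fromℕ 1 * ½
      ℓ≤½ = *-cancelˡ-≤ (0<fromℕ 8) (begin
        fromℕ 8 * ℓ              ≤⟨ <⇒≤ 8ℓ<4 ⟩
        fromℕ 4                  ≈⟨ *-identityʳ _ ⟨
        fromℕ 4 * 1#             ≈⟨ *-congˡ (recipℕ-inverse 2) ⟨
        fromℕ 4 * (fromℕ 2 * ½)  ≈⟨ *-assoc _ _ _ ⟨
        fromℕ 4 * fromℕ 2 * ½    ≈⟨ *-congʳ (fromℕ-* 4 2) ⟨
        fromℕ 8 * ½              ≈⟨ *-congˡ (solve 1 (λ r → r := (con 1 :+ con 0) :* r) refl ½) ⟩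
        fromℕ 8 * (fromℕ 1 * ½)  ∎)

    -- With p > 7ℓ/n and M ≥ n/7, a block of M nodes is silent with probability at most 2/n. Two
    -- blocks give 4/n, and 4 ≤ 8ℓ turns this into 8ℓ/n. The distance from 7 to 8 is the gap that
    -- cotransitivity requires.
    threshold : ∀ M → n ℕ.≤ 7 ℕ.* M → ℓ < 0# ⊎ 0# < ℓ → Threshold M
    -- Placeholder values for the impossible sign: no probability exceeds `c′` = 1, so `crowd` is
    -- vacuous.
    threshold M n≤7M (inj₁ ℓ<0) = record
      { c′ = 1# ; c = fromℕ 2
      ; c′<c = <-respˡ-≈ (+-identityʳ 1#) (fromℕ-mono-< {1} {2} (ℕ.s≤s (ℕ.s≤s ℕ.z≤n)))
      ; 0≤c = 0≤fromℕ 2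
      ; crowd = λ {p} {e} 1<p 0≤e e+p≈1 → contradiction 1<p (begin
          p       ≤⟨ x≤x+y 0≤e ⟩
          p + e   ≈⟨ +-comm p e ⟩
          e + p   ≈⟨ e+p≈1 ⟩
          1#      ∎)
      }
    threshold M n≤7M (inj₂ 0<ℓ) = record
      { c′ = fromℕ 7 * (ℓ * ν) ; c = fromℕ 8 * (ℓ * ν)
      ; c′<c = *-monoˡ-< 0<ℓν (fromℕ-mono-< (ℕ.n<1+n 7))
      ; 0≤c = *-nonneg (0≤fromℕ 8) (<⇒≤ 0<ℓν)
      ; crowd = crowd
      }
      where
      ν = recipℕ n
      0<ℓν = *-pos 0<ℓ (0<recipℕ n)
      ℓ≤Mc′ : ℓ ≤ fromℕ M * (fromℕ 7 * (ℓ * ν))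
      ℓ≤Mc′ = begin
        ℓ                                ≈⟨ *-identityʳ ℓ ⟨
        ℓ * 1#                           ≈⟨ *-congˡ (recipℕ-inverse n) ⟨
        ℓ * (fromℕ n * ν)                ≈⟨ solve 3 (λ l n v → l :* (n :* v) := n :* (l :* v)) refl ℓ (fromℕ n) ν ⟩
        fromℕ n * (ℓ * ν)                ≤⟨ *-monoˡ-≤ (<⇒≤ 0<ℓν) (fromℕ-mono-≤ n≤7M) ⟩
        fromℕ (7 ℕ.* M) * (ℓ * ν)        ≈⟨ *-congʳ (fromℕ-* 7 M) ⟩
        fromℕ 7 * fromℕ M * (ℓ * ν)      ≈⟨ solve 3 (λ s m x → s :* m :* x := m :* (s :* x)) refl (fromℕ 7) (fromℕ M) (ℓ * ν) ⟩
        fromℕ M * (fromℕ 7 * (ℓ * ν))    ∎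
      crowd : ∀ {p e} → fromℕ 7 * (ℓ * ν) < p → 0# ≤ e → e + p ≈ 1# → e ^ M + e ^ M ≤ fromℕ 8 * (ℓ * ν)
      crowd {p} {e} c′<p 0≤e e+p≈1 = *-cancelˡ-≤ 0<n (begin
        fromℕ n * (e ^ M + e ^ M)
          ≈⟨ *-congʳ 2*F½ ⟨
        fromℕ 2 * F½ * (e ^ M + e ^ M)
          ≈⟨ solve 3 (λ t f x → t :* f :* (x :+ x) := t :* (con 1 :+ (con 1 :+ con 0)) :* (f :* x)) refl (fromℕ 2) F½ (e ^ M) ⟩
        fromℕ 2 * fromℕ 2 * (F½ * e ^ M)
          ≤⟨ *-monoʳ-≤ (*-nonneg (0≤fromℕ 2) (0≤fromℕ 2)) (exp-bound M ln (<⇒≤ 0<ℓ)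
               (≤-trans ℓ≤Mc′ (*-monoʳ-≤ (0≤fromℕ M) (<⇒≤ c′<p))) 0≤p 0≤e e+p≈1) ⟩
        fromℕ 2 * fromℕ 2 * 1#
          ≈⟨ *-identityʳ _ ⟩
        fromℕ 2 * fromℕ 2
          ≈⟨ fromℕ-* 2 2 ⟨
        fromℕ 4
          ≤⟨ 4≤8ℓ 0<ℓ ⟩
        fromℕ 8 * ℓ
          ≈⟨ *-identityʳ _ ⟨
        fromℕ 8 * ℓ * 1#
          ≈⟨ *-congˡ (recipℕ-inverse n) ⟨
        fromℕ 8 * ℓ * (fromℕ n * ν)
          ≈⟨ solve 4 (λ e l n v → e :* l :* (n :* v) := n :* (e :* (l :* v))) refl (fromℕ 8) ℓ (fromℕ n) ν ⟩
        fromℕ n * (fromℕ 8 * (ℓ * ν)) ∎)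
        where
        0≤p : 0# ≤ p
        0≤p = ≤-trans (*-nonneg (0≤fromℕ 7) (<⇒≤ 0<ℓν)) (<⇒≤ c′<p)

    -- Here 3c = 24ℓ/n and q = n²/(96ℓ), so q · 3c = n/4. For negative ℓ, `N<q` makes q nonnegative,
    -- and then q · 96ℓ could not be the positive number n².
    threshold-rate : ∀ M (n≤7M : n ℕ.≤ 7 ℕ.* M) sign → let open Threshold (threshold M n≤7M sign) in
      ∀ N → fromℕ N < q → fromℕ N * (fromℕ 3 * c) ≤ fromℕ n * recipℕ 4
    threshold-rate M n≤7M (inj₁ ℓ<0) N N<q = contradiction 0<n² (begin
      fromℕ (n ℕ.^ 2)        ≈⟨ qℓ ⟨
      q * (fromℕ 96 * ℓ)     ≤⟨ *-monoʳ-≤ 0≤q (*-monoʳ-≤ (0≤fromℕ 96) (<⇒≤ ℓ<0)) ⟩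
      q * (fromℕ 96 * 0#)    ≈⟨ trans (*-congˡ (zeroʳ _)) (zeroʳ _) ⟩
      0#                     ∎)
      where
      0≤q : 0# ≤ q
      0≤q = ≤-trans (0≤fromℕ N) (<⇒≤ N<q)
    threshold-rate M n≤7M (inj₂ 0<ℓ) N N<q = *-cancelˡ-≤ (0<fromℕ 4) (*-cancelˡ-≤ 0<n (begin
      fromℕ n * (fromℕ 4 * (fromℕ N * (fromℕ 3 * (fromℕ 8 * (ℓ * ν)))))
        ≈⟨ solve 7 (λ n f N t e l v → n :* (f :* (N :* (t :* (e :* (l :* v))))) := n :* v :* (N :* (t :* e :* f :* l)))
             refl (fromℕ n) (fromℕ 4) (fromℕ N) (fromℕ 3) (fromℕ 8) ℓ ν ⟩
      fromℕ n * ν * (fromℕ N * (fromℕ 3 * fromℕ 8 * fromℕ 4 * ℓ))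
        ≈⟨ *-cong (recipℕ-inverse n) (*-congˡ (*-congʳ (trans (*-congʳ (sym (fromℕ-* 3 8))) (sym (fromℕ-* 24 4))))) ⟩
      1# * (fromℕ N * (fromℕ 96 * ℓ))
        ≈⟨ *-identityˡ _ ⟩
      fromℕ N * (fromℕ 96 * ℓ)
        ≤⟨ *-monoˡ-≤ (*-nonneg (0≤fromℕ 96) (<⇒≤ 0<ℓ)) (<⇒≤ N<q) ⟩
      q * (fromℕ 96 * ℓ)
        ≈⟨ trans qℓ n² ⟩
      fromℕ n * fromℕ n
        ≈⟨ *-congˡ (*-identityʳ _) ⟨
      fromℕ n * (fromℕ n * 1#)
        ≈⟨ *-congˡ (*-congˡ (recipℕ-inverse 4)) ⟨
      fromℕ n * (fromℕ n * (fromℕ 4 * recipℕ 4))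
        ≈⟨ *-congˡ (solve 3 (λ a b c → a :* (b :* c) := b :* (a :* c)) refl (fromℕ n) (fromℕ 4) (recipℕ 4)) ⟩
      fromℕ n * (fromℕ 4 * (fromℕ n * recipℕ 4)) ∎))
      where ν = recipℕ n

  module _ (n m α : ℕ) .{{_ : NonZero n}} (n≤2m : n ℕ.≤ m ℕ.+ m) {q ρ a pr : ℝ} (0≤a : 0# ≤ a)
           (ρ²≈½ⁿ : IsSqrt ((1# /ℕ 2) ^ n) ρ)
           (rate : ∀ N → fromℕ N < q → fromℕ N * a ≤ fromℕ n * recipℕ 4) where

    private
      y = 1# + a
      1≤y : 1# ≤ y
      1≤y = x≤x+y 0≤a
      0≤ρ = proj₁ ρ²≈½ⁿ
      ¼ = recipℕ 4
      ¾ = fromℕ 3 * ¼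
      0≤¾ = *-nonneg (0≤fromℕ 3) (0≤recipℕ 4)

      ¾+¼ : ¾ + ¼ ≈ 1#
      ¾+¼ = trans (solve 2 (λ t r → t :* r :+ r := (con 1 :+ t) :* r) refl (fromℕ 3) ¼) (recipℕ-inverse 4)

      0≤4^m : 0# ≤ fromℕ 4 ^ m
      0≤4^m = ^-nonneg m (0≤fromℕ 4)

      1≤4 : 1# ≤ fromℕ 4
      1≤4 = ≤-trans (≈⇒≤ (sym (+-identityʳ 1#))) (fromℕ-mono-≤ {1} {4} (ℕ.s≤s ℕ.z≤n))

      0<8 : 0# < fromℕ 8
      0<8 = 0<fromℕ 8

      4^n≤ : fromℕ 4 ^ n ≤ fromℕ 4 ^ m * fromℕ 4 ^ m
      4^n≤ = begin
        fromℕ 4 ^ n                                 ≈⟨ *-identityʳ _ ⟨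
        fromℕ 4 ^ n * 1#                            ≤⟨ *-monoʳ-≤ (^-nonneg n (0≤fromℕ 4)) (1≤^ (m ℕ.+ m ∸ n) 1≤4) ⟩
        fromℕ 4 ^ n * fromℕ 4 ^ (m ℕ.+ m ∸ n)       ≈⟨ ^-homo-* (fromℕ 4) n _ ⟨
        fromℕ 4 ^ (n ℕ.+ (m ℕ.+ m ∸ n))             ≡⟨ ≡.cong (fromℕ 4 ^_) (ℕ.m+[n∸m]≡n n≤2m) ⟩
        fromℕ 4 ^ (m ℕ.+ m)                         ≈⟨ ^-homo-* (fromℕ 4) m m ⟩
        fromℕ 4 ^ m * fromℕ 4 ^ m                   ∎

      constants : (1# /ℕ 2) * fromℕ 4 * (¾ * ¾) * fromℕ 8 ≈ fromℕ 9
      constants = begin-equality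
        (1# * recipℕ 2) * fromℕ 4 * (¾ * ¾) * fromℕ 8
          ≈⟨ *-cong (*-congʳ (*-congʳ (*-identityˡ _))) (fromℕ-* 2 4) ⟩
        recipℕ 2 * fromℕ 4 * (¾ * ¾) * (fromℕ 2 * fromℕ 4)
          ≈⟨ solve 5 (λ r f t s w → r :* f :* (t :* s :* (t :* s)) :* (w :* f) := w :* r :* (f :* s) :* (f :* s) :* (t :* t))
               refl (recipℕ 2) (fromℕ 4) (fromℕ 3) ¼ (fromℕ 2) ⟩
        fromℕ 2 * recipℕ 2 * (fromℕ 4 * ¼) * (fromℕ 4 * ¼) * (fromℕ 3 * fromℕ 3)
          ≈⟨ *-cong (*-cong (*-cong (recipℕ-inverse 2) (recipℕ-inverse 4)) (recipℕ-inverse 4)) (sym (fromℕ-* 3 3)) ⟩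
        1# * 1# * 1# * fromℕ 9
          ≈⟨ trans (*-congʳ (trans (*-congʳ (*-identityˡ 1#)) (*-identityˡ 1#))) (*-identityˡ _) ⟩
        fromℕ 9 ∎

      -- Too short a time would force X ≤ 1, whereas X² is at least (1/2 · 4 · 9/16)^n = (9/8)^n.
      -- The comparison is carried out as 9^n against 8^n to avoid fractions.
      X = ρ * fromℕ 4 ^ m * ¾ ^ n

      0≤X : 0# ≤ X
      0≤X = *-nonneg (*-nonneg 0≤ρ 0≤4^m) (^-nonneg n 0≤¾)

      9ⁿ≤X²8ⁿ : fromℕ 9 ^ n ≤ X * X * fromℕ 8 ^ n
      9ⁿ≤X²8ⁿ = begin
        fromℕ 9 ^ n
          ≈⟨ ^-congˡ n constants ⟨
        ((1# /ℕ 2) * fromℕ 4 * (¾ * ¾) * fromℕ 8) ^ n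
          ≈⟨ trans (sym (^-distrib _ _ n)) (*-congʳ (trans (sym (^-distrib _ _ n)) (*-cong (sym (^-distrib _ _ n)) (sym (^-distrib _ _ n))))) ⟩
        (1# /ℕ 2) ^ n * fromℕ 4 ^ n * (¾ ^ n * ¾ ^ n) * fromℕ 8 ^ n
          ≤⟨ *-monoˡ-≤ (^-nonneg n (0≤fromℕ 8)) (*-monoˡ-≤ (*-nonneg (^-nonneg n 0≤¾) (^-nonneg n 0≤¾))
               (*-mono-≤ (*-nonneg 0≤ρ 0≤ρ) (^-nonneg n (0≤fromℕ 4)) (≈⇒≤ (sym (proj₂ ρ²≈½ⁿ))) 4^n≤)) ⟩
        ρ * ρ * (fromℕ 4 ^ m * fromℕ 4 ^ m) * (¾ ^ n * ¾ ^ n) * fromℕ 8 ^ n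
          ≈⟨ *-congʳ (solve 3 (λ r f t → r :* r :* (f :* f) :* (t :* t) := r :* f :* t :* (r :* f :* t)) refl ρ (fromℕ 4 ^ m) (¾ ^ n)) ⟩
        X * X * fromℕ 8 ^ n ∎

      X≰1 : ¬ X ≤ 1#
      X≰1 X≤1 = (begin
        fromℕ 9 ^ n                ≤⟨ 9ⁿ≤X²8ⁿ ⟩
        X * X * fromℕ 8 ^ n        ≤⟨ *-monoˡ-≤ (^-nonneg n (0≤fromℕ 8)) (*-mono-≤ (<⇒≤ 0<1) 0≤X X≤1 X≤1) ⟩
        1# * 1# * fromℕ 8 ^ n      ≈⟨ trans (*-congʳ (*-identityˡ 1#)) (*-identityˡ _) ⟩
        fromℕ 8 ^ n                ∎) (^-mono-< n 0<8 (fromℕ-mono-< (ℕ.n<1+n 8)))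

      -- The α m idle slots absorb the summand α n/2 because n ≤ 2m; what remains of T is below q.
      -- If T ≤ α m, truncated subtraction leaves nothing to bound.
      excess : ∀ T → fromℕ T < fromℕ (α ℕ.* n) /ℕ 2 + q →
        fromℕ (T ∸ α ℕ.* m) * a ≤ fromℕ n * ¼
      excess T T<αn/2+q with T ℕ.≤? α ℕ.* m
      ... | yes T≤αm = ≤-trans (≈⇒≤ (trans (*-congʳ (reflexive (≡.cong fromℕ (ℕ.m≤n⇒m∸n≡0 T≤αm)))) (zeroˡ a)))
                               (*-nonneg (0≤fromℕ n) (0≤recipℕ 4))
      ... | no  T≰αm = rate (T ∸ α ℕ.* m) (+-cancelʳ-< (fromℕ (α ℕ.* m)) (begin-strict
        fromℕ (T ∸ α ℕ.* m) + fromℕ (α ℕ.* m)  ≈⟨ fromℕ-+ (T ∸ α ℕ.* m) (α ℕ.* m) ⟨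
        fromℕ (T ∸ α ℕ.* m ℕ.+ α ℕ.* m)        ≡⟨ ≡.cong fromℕ (ℕ.m∸n+n≡m (ℕ.<⇒≤ (ℕ.≰⇒> T≰αm))) ⟩
        fromℕ T                                <⟨ T<αn/2+q ⟩
        fromℕ (α ℕ.* n) /ℕ 2 + q               ≤⟨ +-monoˡ-≤ q αn/2≤αm ⟩
        fromℕ (α ℕ.* m) + q                    ≈⟨ +-comm _ q ⟩
        q + fromℕ (α ℕ.* m)                    ∎))
        where
        αn/2≤αm : fromℕ (α ℕ.* n) /ℕ 2 ≤ fromℕ (α ℕ.* m)
        αn/2≤αm = *-cancelˡ-≤ (0<fromℕ 2) (begin
          fromℕ 2 * (fromℕ (α ℕ.* n) /ℕ 2)  ≈⟨ /ℕ-cancel _ 2 ⟩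
          fromℕ (α ℕ.* n)                   ≤⟨ fromℕ-mono-≤ (ℕ.≤-trans (ℕ.*-monoʳ-≤ α n≤2m)
              (ℕ.≤-reflexive (≡.trans (ℕ.*-distribˡ-+ α m m) (≡.cong (α ℕ.* m ℕ.+_) (≡.sym (ℕ.+-identityʳ _)))))) ⟩
          fromℕ (2 ℕ.* (α ℕ.* m))           ≈⟨ fromℕ-* 2 (α ℕ.* m) ⟩
          fromℕ 2 * fromℕ (α ℕ.* m)         ∎)

    time-bound : ∀ T → pr * (y ^ (α ℕ.* m) * fromℕ 4 ^ m) ≤ y ^ T → ρ ≤ pr →
      fromℕ (α ℕ.* n) /ℕ 2 + q ≤ fromℕ T
    -- The last argument comes from unfolding the negation in `≤`: it is the assumption that T is
    -- too small.
    time-bound T pr-bound ρ≤pr T<bound = X≰1 (≤-trans (*-monoˡ-≤ (^-nonneg n 0≤¾) ρ4^m≤y^N)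
      ([1+a]^N*[1-b]^M≤1 N n 0≤a (0≤recipℕ 4) 0≤¾ ¾+¼ (excess T T<bound)))
      where
      N = T ∸ α ℕ.* m
      0<y^ : 0# < y ^ (α ℕ.* m)
      0<y^ = ^-pos (α ℕ.* m) (<-≤-trans 0<1 1≤y)
      y^T≤ : y ^ T ≤ y ^ (α ℕ.* m) * y ^ N
      y^T≤ = begin
        y ^ T                                     ≈⟨ *-identityʳ _ ⟨
        y ^ T * 1#                                ≤⟨ *-monoʳ-≤ (^-nonneg T (≤-trans (<⇒≤ 0<1) 1≤y)) (1≤^ (α ℕ.* m ℕ.+ N ∸ T) 1≤y) ⟩
        y ^ T * y ^ (α ℕ.* m ℕ.+ N ∸ T)           ≈⟨ ^-homo-* y T _ ⟨
        y ^ (T ℕ.+ (α ℕ.* m ℕ.+ N ∸ T))           ≡⟨ ≡.cong (y ^_) (ℕ.m+[n∸m]≡n (ℕ.m≤n+m∸n T (α ℕ.* m))) ⟩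
        y ^ (α ℕ.* m ℕ.+ N)                       ≈⟨ ^-homo-* y (α ℕ.* m) N ⟩
        y ^ (α ℕ.* m) * y ^ N                     ∎
      ρ4^m≤y^N : ρ * fromℕ 4 ^ m ≤ y ^ N
      ρ4^m≤y^N = *-cancelˡ-≤ 0<y^ (begin
        y ^ (α ℕ.* m) * (ρ * fromℕ 4 ^ m)   ≈⟨ solve 3 (λ y r f → y :* (r :* f) := r :* (y :* f)) refl _ ρ (fromℕ 4 ^ m) ⟩
        ρ * (y ^ (α ℕ.* m) * fromℕ 4 ^ m)   ≤⟨ *-monoˡ-≤ (*-nonneg (<⇒≤ 0<y^) 0≤4^m) ρ≤pr ⟩
        pr * (y ^ (α ℕ.* m) * fromℕ 4 ^ m)  ≤⟨ pr-bound ⟩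
        y ^ T                               ≤⟨ y^T≤ ⟩
        y ^ (α ℕ.* m) * y ^ N               ∎)

-- Finite expectations and independence

module ExpectationProperties (R : Reals) where

  open Reals R hiding (zero)
  open RealFunctions R
  open OrderedFieldProperties R
  open ≤-Reasoning

  Positive : {A : Set} → Weighted A → Set
  Positive = All (λ (w , _) → 0# < w)

  module _ {A : Set} where

    𝔼-mono-≤ : {D : Weighted A} {f g : A → ℝ} → Positive D →
      (∀ a → a ∈ outcomes D → f a ≤ g a) → 𝔼 D f ≤ 𝔼 D g
    𝔼-mono-≤ []          f≤g = ≤-refl
    𝔼-mono-≤ (0<w ∷ 0<D) f≤g = +-mono-≤ (*-monoʳ-≤ (<⇒≤ 0<w) (f≤g _ (here ≡.refl)))
      (𝔼-mono-≤ 0<D λ a a∈D → f≤g a (there a∈D))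

    𝔼-cong : (D : Weighted A) {f g : A → ℝ} → (∀ a → f a ≈ g a) → 𝔼 D f ≈ 𝔼 D g
    𝔼-cong []            f≈g = refl
    𝔼-cong ((w , a) ∷ D) f≈g = +-cong (*-congˡ (f≈g a)) (𝔼-cong D f≈g)

    𝔼-* : (D : Weighted A) (k : ℝ) (f : A → ℝ) → 𝔼 D (λ a → k * f a) ≈ k * 𝔼 D f
    𝔼-* []            k f = sym (zeroʳ k)
    𝔼-* ((w , a) ∷ D) k f = trans (+-congˡ (𝔼-* D k f))
      (solve 4 (λ w k f e → w :* (k :* f) :+ k :* e := k :* (w :* f :+ e)) refl w k (f a) (𝔼 D f))

    𝔼-+ : (D : Weighted A) (f g : A → ℝ) → 𝔼 D (λ a → f a + g a) ≈ 𝔼 D f + 𝔼 D g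
    𝔼-+ []            f g = sym (+-identityˡ 0#)
    𝔼-+ ((w , a) ∷ D) f g = trans (+-congˡ (𝔼-+ D f g))
      (solve 5 (λ w f g F G → w :* (f :+ g) :+ (F :+ G) := w :* f :+ F :+ (w :* g :+ G)) refl
        w (f a) (g a) (𝔼 D f) (𝔼 D g))

    𝔼-const : {D : Weighted A} → IsDistribution D → ∀ k → 𝔼 D (λ _ → k) ≈ k
    𝔼-const {D} (_ , total) k = begin-equality
      𝔼 D (λ _ → k)       ≈⟨ 𝔼-cong D (λ _ → *-identityʳ k) ⟨
      𝔼 D (λ _ → k * 1#)  ≈⟨ 𝔼-* D k (λ _ → 1#) ⟩
      k * 𝔼 D (λ _ → 1#)  ≈⟨ *-congˡ total ⟩
      k * 1#              ≈⟨ *-identityʳ k ⟩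
      k                   ∎

    𝔼-nonneg : {D : Weighted A} {f : A → ℝ} → Positive D → (∀ a → 0# ≤ f a) → 0# ≤ 𝔼 D f
    𝔼-nonneg []          0≤f = ≤-refl
    𝔼-nonneg (0<w ∷ 0<D) 0≤f = +-nonneg (*-nonneg (<⇒≤ 0<w) (0≤f _)) (𝔼-nonneg 0<D 0≤f)

    point-isDistribution : (a : A) → IsDistribution ((1# , a) ∷ [])
    point-isDistribution a = 0<1 ∷ [] , trans (+-identityʳ _) (*-identityʳ 1#)

    module _ {B : Set} (φ : A → B) where

      push : Weighted A → Weighted B
      push = map (λ (w , a) → w , φ a)

      𝔼-push : ∀ D (f : B → ℝ) → 𝔼 (push D) f ≈ 𝔼 D (λ a → f (φ a))
      𝔼-push []            f = refl
      𝔼-push ((w , a) ∷ D) f = +-congˡ (𝔼-push D f)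

      push-positive : ∀ {D} → Positive D → Positive (push D)
      push-positive []          = []
      push-positive (0<w ∷ 0<D) = 0<w ∷ push-positive 0<D

      push-isDistribution : ∀ {D} → IsDistribution D → IsDistribution (push D)
      push-isDistribution {D} (0<D , total) = push-positive 0<D , trans (𝔼-push D (λ _ → 1#)) total

  ∏ : ∀ {n} → (Fin n → ℝ) → ℝ
  ∏ {zero}  φ = 1#
  ∏ {suc n} φ = φ Fin.zero * ∏ (λ u → φ (Fin.suc u))

  ∏-nonneg : ∀ {n} (φ : Fin n → ℝ) → (∀ u → 0# ≤ φ u) → 0# ≤ ∏ φ
  ∏-nonneg {zero}  φ 0≤φ = <⇒≤ 0<1
  ∏-nonneg {suc n} φ 0≤φ = *-nonneg (0≤φ _) (∏-nonneg (λ u → φ (Fin.suc u)) λ u → 0≤φ _)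

  ∏-mono-≤ : ∀ {n} {φ ψ : Fin n → ℝ} → (∀ u → 0# ≤ φ u) → (∀ u → φ u ≤ ψ u) → ∏ φ ≤ ∏ ψ
  ∏-mono-≤ {zero}  0≤φ φ≤ψ = ≤-refl
  ∏-mono-≤ {suc n} 0≤φ φ≤ψ = *-mono-≤ (≤-trans (0≤φ _) (φ≤ψ _)) (∏-nonneg _ λ u → 0≤φ (Fin.suc u))
    (φ≤ψ _) (∏-mono-≤ (λ u → 0≤φ (Fin.suc u)) λ u → φ≤ψ (Fin.suc u))

  ∏-1≤ : ∀ {n} {φ : Fin n → ℝ} → (∀ u → 1# ≤ φ u) → 1# ≤ ∏ φ
  ∏-1≤ {zero}  1≤φ = ≤-refl
  ∏-1≤ {suc n} 1≤φ = ≤-trans (≈⇒≤ (sym (*-identityˡ 1#)))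
    (*-mono-≤ (≤-trans (<⇒≤ 0<1) (1≤φ _)) (<⇒≤ 0<1) (1≤φ _) (∏-1≤ λ u → 1≤φ (Fin.suc u)))

  -- block lo M k decides lo ≤ k < lo + M.
  block : ℕ → ℕ → ℕ → Bool
  block zero     zero    k       = false
  block zero     (suc M) zero    = true
  block zero     (suc M) (suc k) = block zero M k
  block (suc lo) M       zero    = false
  block (suc lo) M       (suc k) = block lo M k

  block⇒< : ∀ lo M k → block lo M k ≡ true → k ℕ.< lo ℕ.+ M
  block⇒< zero     (suc M) zero    b = ℕ.z<s
  block⇒< zero     (suc M) (suc k) b = ℕ.s≤s (block⇒< zero M k b)
  block⇒< (suc lo) M       (suc k) b = ℕ.s≤s (block⇒< lo M k b)

  block⇒≥ : ∀ lo M k → block lo M k ≡ true → lo ℕ.≤ k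
  block⇒≥ zero     M k       b = ℕ.z≤n
  block⇒≥ (suc lo) M (suc k) b = ℕ.s≤s (block⇒≥ lo M k b)

  ∏-block : ∀ {n} lo M e → lo ℕ.+ M ℕ.≤ n → ∏ {n} (λ u → if block lo M (toℕ u) then e else 1#) ≈ e ^ M
  ∏-block {zero}  zero     zero    e lo+M≤n = refl
  ∏-block {suc n} zero     zero    e lo+M≤n = trans (*-identityˡ _) (∏-block {n} zero zero e ℕ.z≤n)
  ∏-block {suc n} zero     (suc M) e lo+M≤n = *-congˡ (∏-block zero M e (ℕ.s≤s⁻¹ lo+M≤n))
  ∏-block {suc n} (suc lo) M       e lo+M≤n = trans (*-identityˡ _) (∏-block lo M e (ℕ.s≤s⁻¹ lo+M≤n))

  module _ {A : Set} where

    𝔼-joint-cong : ∀ {n} (D : Fin n → Weighted A) {f g : Vec A n → ℝ} →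
      (∀ as → f as ≈ g as) → 𝔼-joint D f ≈ 𝔼-joint D g
    𝔼-joint-cong {zero}  D f≈g = f≈g []
    𝔼-joint-cong {suc n} D f≈g = 𝔼-cong (D Fin.zero) λ a → 𝔼-joint-cong _ λ as → f≈g (a ∷ as)

    𝔼-joint-* : ∀ {n} (D : Fin n → Weighted A) k (f : Vec A n → ℝ) →
      𝔼-joint D (λ as → k * f as) ≈ k * 𝔼-joint D f
    𝔼-joint-* {zero}  D k f = refl
    𝔼-joint-* {suc n} D k f = trans
      (𝔼-cong (D Fin.zero) λ a → 𝔼-joint-* (λ u → D (Fin.suc u)) k λ as → f (a ∷ as))
      (𝔼-* (D Fin.zero) k _)

    𝔼-joint-+ : ∀ {n} (D : Fin n → Weighted A) (f g : Vec A n → ℝ) →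
      𝔼-joint D (λ as → f as + g as) ≈ 𝔼-joint D f + 𝔼-joint D g
    𝔼-joint-+ {zero}  D f g = refl
    𝔼-joint-+ {suc n} D f g = trans
      (𝔼-cong (D Fin.zero) λ a → 𝔼-joint-+ (λ u → D (Fin.suc u)) (λ as → f (a ∷ as)) λ as → g (a ∷ as))
      (𝔼-+ (D Fin.zero) _ _)

    -- Independence. It turns the probability that a block of helpers is silent into a power.
    𝔼-joint-∏ : ∀ {n} (D : Fin n → Weighted A) (φ : Fin n → A → ℝ) →
      𝔼-joint D (λ as → ∏ λ u → φ u (lookup as u)) ≈ ∏ (λ u → 𝔼 (D u) (φ u))
    𝔼-joint-∏ {zero}  D φ = refl
    𝔼-joint-∏ {suc n} D φ = begin-equality
      𝔼 (D Fin.zero) (λ a → 𝔼-joint D′ λ as → φ Fin.zero a * ∏ λ u → φ′ u (lookup as u))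
        ≈⟨ 𝔼-cong (D Fin.zero) (λ a → trans (𝔼-joint-* D′ _ _) (*-comm _ _)) ⟩
      𝔼 (D Fin.zero) (λ a → 𝔼-joint D′ (λ as → ∏ λ u → φ′ u (lookup as u)) * φ Fin.zero a)
        ≈⟨ 𝔼-* (D Fin.zero) _ _ ⟩
      𝔼-joint D′ (λ as → ∏ λ u → φ′ u (lookup as u)) * 𝔼 (D Fin.zero) (φ Fin.zero)
        ≈⟨ *-comm _ _ ⟩
      𝔼 (D Fin.zero) (φ Fin.zero) * 𝔼-joint D′ (λ as → ∏ λ u → φ′ u (lookup as u))
        ≈⟨ *-congˡ (𝔼-joint-∏ D′ φ′) ⟩
      ∏ (λ u → 𝔼 (D u) (φ u)) ∎
      where
      D′ = λ u → D (Fin.suc u)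
      φ′ = λ u → φ (Fin.suc u)

    Independent : ∀ {n} → (Fin n → Weighted A) → Set
    Independent D = ∀ u → IsDistribution (D u)

    Possible : ∀ {n} → (Fin n → Weighted A) → Vec A n → Set
    Possible D as = ∀ u → lookup as u ∈ outcomes (D u)

    -- Restricting the comparison to possible draws matters: sleeping nodes are silent, and longer
    -- histories reachable, only for those.
    𝔼-joint-mono-≤ : ∀ {n} {D : Fin n → Weighted A} {f g : Vec A n → ℝ} → Independent D →
      (∀ as → Possible D as → f as ≤ g as) → 𝔼-joint D f ≤ 𝔼-joint D g
    𝔼-joint-mono-≤ {zero}  D-dist f≤g = f≤g [] λ ()
    𝔼-joint-mono-≤ {suc n} D-dist f≤g = 𝔼-mono-≤ (proj₁ (D-dist Fin.zero)) λ a a∈D →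
      𝔼-joint-mono-≤ (λ u → D-dist (Fin.suc u)) λ as as∈D → f≤g (a ∷ as) λ where
        Fin.zero    → a∈D
        (Fin.suc u) → as∈D u

    𝔼-joint-const : ∀ {n} {D : Fin n → Weighted A} → Independent D → ∀ k → 𝔼-joint D (λ _ → k) ≈ k
    𝔼-joint-const {zero}      D-dist k = refl
    𝔼-joint-const {suc n} {D} D-dist k = trans
      (𝔼-cong (D Fin.zero) λ _ → 𝔼-joint-const (λ u → D-dist (Fin.suc u)) k)
      (𝔼-const (D-dist Fin.zero) k)

    𝔼-joint-marginal : ∀ {n} {D : Fin n → Weighted A} → Independent D → ∀ u (f : A → ℝ) →
      𝔼-joint D (λ as → f (lookup as u)) ≈ 𝔼 (D u) f
    𝔼-joint-marginal {D = D} D-dist Fin.zero f =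
      𝔼-cong (D Fin.zero) λ a → 𝔼-joint-const (λ u → D-dist (Fin.suc u)) (f a)
    𝔼-joint-marginal {D = D} D-dist (Fin.suc u) f = trans
      (𝔼-cong (D Fin.zero) λ a → 𝔼-joint-marginal (λ u → D-dist (Fin.suc u)) u f)
      (𝔼-const (D-dist Fin.zero) _)

  indicator-mono : ∀ {b b′} → (b ≡ true → b′ ≡ true) → indicator b ≤ indicator b′
  indicator-mono {true}  {true}  h = ≤-refl
  indicator-mono {true}  {false} h = contradiction (h ≡.refl) λ ()
  indicator-mono {false} {true}  h = <⇒≤ 0<1
  indicator-mono {false} {false} h = ≤-refl

  0≤indicator : ∀ b → 0# ≤ indicator b
  0≤indicator true  = <⇒≤ 0<1
  0≤indicator false = ≤-refl

  indicator≤1 : ∀ b → indicator b ≤ 1#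
  indicator≤1 true  = ≤-refl
  indicator≤1 false = <⇒≤ 0<1

  indicator-not : ∀ b → indicator (not b) + indicator b ≈ 1#
  indicator-not true  = +-identityˡ 1#
  indicator-not false = +-identityʳ 1#

-- Node positions on a lattice of one line

∣-∣-≤ : ∀ a b {L} → a ℕ.≤ b ℕ.+ L → b ℕ.≤ a ℕ.+ L → ∣ a - b ∣ ℕ.≤ L
∣-∣-≤ a b a≤b+L b≤a+L with ℕ.≤-total a b
... | inj₁ a≤b = ℕ.≤-trans (ℕ.≤-reflexive (ℕ.m≤n⇒∣m-n∣≡n∸m a≤b)) (ℕ.m≤n+o⇒m∸n≤o b a b≤a+L)
... | inj₂ b≤a = ℕ.≤-trans (ℕ.≤-reflexive (ℕ.m≤n⇒∣n-m∣≡n∸m b≤a)) (ℕ.m≤n+o⇒m∸n≤o a b a≤b+L)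

module LatticePoints (R : Reals) where

  open Reals R hiding (zero)
  open RealFunctions R
  open OrderedFieldProperties R
  open HitRates R
  open ≤-Reasoning
  open import Algebra.Properties.Ring (CommutativeRing.ring commutativeRing)
    using (-‿distribˡ-*; -‿distribʳ-*; -‿involutive; -‿anti-homo-+)

  module _ (η : ℝ) (0<η : 0# < η) where

    -- On one axis the Euclidean distance is the gap of the indices times η. Comparison with a
    -- multiple of η, such as r, is then decidable.
    point : ℕ → Point
    point a = fromℕ a * η , 0#

    private
      x-y : ∀ a k → fromℕ (a ℕ.+ k) * η - fromℕ a * η ≈ fromℕ k * η
      x-y a k = +-cancelʳ-≈ (fromℕ a * η) (trans (x-y+y _ _) (trans (*-congʳ (fromℕ-+ a k))
        (solve 3 (λ a k e → (a :+ k) :* e := k :* e :+ a :* e) refl (fromℕ a) (fromℕ k) η)))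

      y-x : ∀ x y → x - y ≈ - (y - x)
      y-x x y = sym (trans (-‿anti-homo-+ y (- x)) (+-congʳ (-‿involutive x)))

      neg-square : ∀ x → (- x) * (- x) ≈ x * x
      neg-square x = trans (sym (-‿distribˡ-* x (- x))) (trans (-‿cong (sym (-‿distribʳ-* x x))) (-‿involutive _))

      square : ℝ → ℝ
      square x = x * x

      difference² : ∀ a b → square (fromℕ a * η - fromℕ b * η) ≈ square (fromℕ ∣ a - b ∣ * η)
      difference² a b with ℕ.≤-total a b
      ... | inj₂ b≤a rewrite ℕ.m≤n⇒∣n-m∣≡n∸m b≤a = *-cong lemma lemma
        where
        lemma : fromℕ a * η - fromℕ b * η ≈ fromℕ (a ∸ b) * η
        lemma = ≡.subst (λ z → fromℕ z * η - fromℕ b * η ≈ fromℕ (a ∸ b) * η) (ℕ.m+[n∸m]≡n b≤a) (x-y b (a ∸ b))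
      ... | inj₁ a≤b rewrite ℕ.m≤n⇒∣m-n∣≡n∸m a≤b = trans (*-cong lemma lemma) (neg-square _)
        where
        lemma : fromℕ a * η - fromℕ b * η ≈ - (fromℕ (b ∸ a) * η)
        lemma = trans (y-x _ _) (-‿cong (≡.subst (λ z → fromℕ z * η - fromℕ a * η ≈ fromℕ (b ∸ a) * η) (ℕ.m+[n∸m]≡n a≤b) (x-y a (b ∸ a))))

      distance² : ∀ a b → square (fromℕ a * η - fromℕ b * η) + square (0# - 0#) ≈ square (fromℕ ∣ a - b ∣ * η)
      distance² a b = trans (+-cong (difference² a b) (trans (*-congʳ (-‿inverseʳ 0#)) (zeroˡ _))) (+-identityʳ _)

    point-within : ∀ {ρ} a b → fromℕ ∣ a - b ∣ * η ≤ ρ → Within ρ (point a) (point b)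
    point-within {ρ} a b gap≤ρ = ≤-trans 0≤gap gap≤ρ , (begin
      _                            ≈⟨ distance² a b ⟩
      square (fromℕ ∣ a - b ∣ * η) ≤⟨ *-mono-≤ (≤-trans 0≤gap gap≤ρ) 0≤gap gap≤ρ gap≤ρ ⟩
      square ρ                     ∎)
      where
      0≤gap : 0# ≤ fromℕ ∣ a - b ∣ * η
      0≤gap = *-nonneg (0≤fromℕ ∣ a - b ∣) (<⇒≤ 0<η)

    point-within⁻¹ : ∀ {ρ} a b → Within ρ (point a) (point b) → fromℕ ∣ a - b ∣ * η ≤ ρ
    point-within⁻¹ {ρ} a b (0≤ρ , d²≤ρ²) ρ<gap = d²≤ρ² (begin-strict
      square ρ                     ≤⟨ *-monoʳ-≤ 0≤ρ (<⇒≤ ρ<gap) ⟩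
      ρ * (fromℕ ∣ a - b ∣ * η)    <⟨ *-monoˡ-< (≤-<-trans 0≤ρ ρ<gap) ρ<gap ⟩
      square (fromℕ ∣ a - b ∣ * η) ≈⟨ distance² a b ⟨
      _                            ∎)

    point-injective : ∀ {a b} → SamePoint (point a) (point b) → a ≡ b
    point-injective {a} {b} (x≈ , _) = ℕ.≤-antisym (half {a} {b} x≈) (half {b} {a} (sym x≈))
      where
      half : ∀ {a b} → fromℕ a * η ≈ fromℕ b * η → a ℕ.≤ b
      half a≈b = fromℕ-cancel-≤ (*-cancelʳ-≤ 0<η (≈⇒≤ a≈b))

    point-within? : ∀ {ρ} K → fromℕ K * η ≈ ρ → ∀ a b → Dec (Within ρ (point a) (point b))
    point-within? K Kη≈ρ a b = map′
      (λ gap≤K → point-within a b (≤-trans (*-monoˡ-≤ (<⇒≤ 0<η) (fromℕ-mono-≤ gap≤K)) (≈⇒≤ Kη≈ρ)))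
      (λ within → fromℕ-cancel-≤ {∣ a - b ∣} {K} (*-cancelʳ-≤ 0<η (≤-trans (point-within⁻¹ a b within) (≈⇒≤ (sym Kη≈ρ)))))
      (∣ a - b ∣ ℕ.≤? K)

  -- `2n≤K` keeps resting and shifted helpers within range of one another, `nη≤V` allows a shift
  -- within one slot, and `[K+n]η≤d` places all nodes in the target area.
  record Scale (n : ℕ) (r d V : ℝ) : Set where
    field
      K    : ℕ
      η    : ℝ
      0<η  : 0# < η
      Kη≈r : fromℕ K * η ≈ r
      2n≤K : n ℕ.+ n ℕ.≤ K
      nη≤V : fromℕ n * η ≤ V
      [K+n]η≤d : fromℕ (K ℕ.+ n) * η ≤ d

  -- With η = r/K, the two Archimedean witnesses make n η at most V and at most d - r. The latter is
  -- where r < d leaves room for nodes beyond the range of the source.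
  scale : ∀ n {r d V} → 0# < r → r < d → 0# < V → Scale n r d V
  scale n {r} {d} {V} 0<r r<d 0<V = record
    { K = K ; η = η ; 0<η = *-pos 0<r (0<recipℕ K)
    ; Kη≈r = Kη≈r
    ; 2n≤K = ℕ.≤-trans (ℕ.m≤n+m (n ℕ.+ n) (k₁ ℕ.+ k₂)) (ℕ.n≤1+n _)
    ; nη≤V = *-cancelˡ-≤ (0<fromℕ K) (begin
        fromℕ K * (fromℕ n * η)   ≈⟨ swap ⟩
        fromℕ n * r               ≤⟨ <⇒≤ (proj₂ V-scale) ⟩
        fromℕ k₁ * V              ≤⟨ *-monoˡ-≤ (<⇒≤ 0<V) (fromℕ-mono-≤ k₁≤K) ⟩
        fromℕ K * V               ∎)
    ; [K+n]η≤d = *-cancelˡ-≤ (0<fromℕ K) (begin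
        fromℕ K * (fromℕ (K ℕ.+ n) * η)
          ≈⟨ *-congˡ (trans (*-congʳ (fromℕ-+ K n)) (distribʳ η _ _)) ⟩
        fromℕ K * (fromℕ K * η + fromℕ n * η)
          ≈⟨ trans (distribˡ _ _ _) (+-cong (*-congˡ Kη≈r) swap) ⟩
        fromℕ K * r + fromℕ n * r
          ≤⟨ +-monoʳ-≤ _ (<⇒≤ (proj₂ d-scale)) ⟩
        fromℕ K * r + fromℕ k₂ * (d - r)
          ≤⟨ +-monoʳ-≤ _ (*-monoˡ-≤ (<⇒≤ (x<y⇒0<y-x r<d)) (fromℕ-mono-≤ k₂≤K)) ⟩
        fromℕ K * r + fromℕ K * (d - r)
          ≈⟨ trans (+-comm _ _) (sym (distribˡ _ _ _)) ⟩
        fromℕ K * (d - r + r)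
          ≈⟨ *-congˡ (x-y+y d r) ⟩
        fromℕ K * d ∎)
    }
    where
    V-scale = archimedean-* (fromℕ n * r) 0<V
    d-scale = archimedean-* (fromℕ n * r) (x<y⇒0<y-x r<d)
    k₁ = proj₁ V-scale
    k₂ = proj₁ d-scale
    K = suc (k₁ ℕ.+ k₂ ℕ.+ (n ℕ.+ n))
    k₁≤K : k₁ ℕ.≤ K
    k₁≤K = ℕ.≤-trans (ℕ.≤-trans (ℕ.m≤m+n k₁ k₂) (ℕ.m≤m+n _ _)) (ℕ.n≤1+n _)
    k₂≤K : k₂ ℕ.≤ K
    k₂≤K = ℕ.≤-trans (ℕ.≤-trans (ℕ.m≤n+m k₂ k₁) (ℕ.m≤m+n _ _)) (ℕ.n≤1+n _)
    η = r /ℕ K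
    Kη≈r = /ℕ-cancel r K
    swap : fromℕ K * (fromℕ n * η) ≈ fromℕ n * r
    swap = trans (solve 3 (λ k n e → k :* (n :* e) := n :* (k :* e)) refl (fromℕ K) (fromℕ n) η) (*-congˡ Kη≈r)

module Placement (n h K : ℕ) (h≤n : h ℕ.≤ n) (2n≤K : n ℕ.+ n ℕ.≤ K) where

  -- For a helper u and another node v, the gap at rest is K + v - u > K since u < v. After a shift
  -- by n it is K + v - n - u, at most K since v ≤ n. The summand `toℕ u` keeps positions distinct.
  coordinate : (Fin n → Bool) → Fin n → ℕ
  coordinate shift u =
    if toℕ u <ᵇ h then (if shift u then n ℕ.+ toℕ u else toℕ u) else K ℕ.+ toℕ u

  data Place (u : Fin n) (b : Bool) : ℕ → Set where
    resting : toℕ u ℕ.< h → b ≡ false → Place u b (toℕ u)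
    shifted : toℕ u ℕ.< h → b ≡ true → Place u b (n ℕ.+ toℕ u)
    beyond  : h ℕ.≤ toℕ u → Place u b (K ℕ.+ toℕ u)

  place : ∀ shift u → Place u (shift u) (coordinate shift u)
  place shift u with toℕ u <ᵇ h in u<h? | shift u
  ... | true  | true  = shifted (ℕ.<ᵇ⇒< _ _ (≡.subst T (≡.sym u<h?) _)) ≡.refl
  ... | true  | false = resting (ℕ.<ᵇ⇒< _ _ (≡.subst T (≡.sym u<h?) _)) ≡.refl
  ... | false | _     = beyond (ℕ.≮⇒≥ λ u<h → ≡.subst T u<h? (ℕ.<⇒<ᵇ u<h))

  private
    u≤n : (u : Fin n) → toℕ u ℕ.≤ n
    u≤n u = ℕ.<⇒≤ (Fin.toℕ<n u)

    place≤K+n : ∀ {u b a} → Place u b a → a ℕ.≤ K ℕ.+ n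
    place≤K+n {u} (resting _ _) = ℕ.≤-trans (u≤n u) (ℕ.m≤n+m n K)
    place≤K+n {u} (shifted _ _) = ℕ.≤-trans (ℕ.+-monoʳ-≤ n (u≤n u)) (ℕ.≤-trans 2n≤K (ℕ.m≤m+n K n))
    place≤K+n {u} (beyond _)    = ℕ.+-monoʳ-≤ K (u≤n u)

    helper-place<K : ∀ {u b a} → toℕ u ℕ.< h → Place u b a → a ℕ.< K
    helper-place<K {u} u<h (resting _ _) = ℕ.<-≤-trans (Fin.toℕ<n u) (ℕ.≤-trans (ℕ.m≤m+n n n) 2n≤K)
    helper-place<K {u} u<h (shifted _ _) = ℕ.<-≤-trans (ℕ.+-monoʳ-< n (Fin.toℕ<n u)) 2n≤K
    helper-place<K u<h (beyond h≤u)      = contradiction u<h (ℕ.≤⇒≯ h≤u)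

  gap≤K+n : ∀ {u v b b′ x y} → Place u b x → Place v b′ y → ∣ x - y ∣ ℕ.≤ K ℕ.+ n
  gap≤K+n {x = x} {y} p q = ∣-∣-≤ x y (ℕ.≤-trans (place≤K+n p) (ℕ.m≤n+m _ y)) (ℕ.≤-trans (place≤K+n q) (ℕ.m≤n+m _ x))

  helpers-gap≤K : ∀ {u v b b′ x y} → toℕ u ℕ.< h → toℕ v ℕ.< h → Place u b x → Place v b′ y → ∣ x - y ∣ ℕ.≤ K
  helpers-gap≤K {x = x} {y} u<h v<h p q = ∣-∣-≤ x y (ℕ.≤-trans (ℕ.<⇒≤ (helper-place<K u<h p)) (ℕ.m≤n+m _ _))
                                    (ℕ.≤-trans (ℕ.<⇒≤ (helper-place<K v<h q)) (ℕ.m≤n+m _ _))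

  step-gap≤n : ∀ {u b b′ x y} → Place u b x → Place u b′ y → ∣ x - y ∣ ℕ.≤ n
  step-gap≤n {u} (resting _ _) (resting _ _) = ∣-∣-≤ (toℕ u) (toℕ u) (ℕ.m≤m+n _ _) (ℕ.m≤m+n _ _)
  step-gap≤n {u} (resting _ _) (shifted _ _) = ∣-∣-≤ (toℕ u) (n ℕ.+ toℕ u) (ℕ.≤-trans (ℕ.m≤n+m _ n) (ℕ.m≤m+n _ _)) (ℕ.≤-reflexive (ℕ.+-comm n (toℕ u)))
  step-gap≤n {u} (shifted _ _) (resting _ _) = ∣-∣-≤ (n ℕ.+ toℕ u) (toℕ u) (ℕ.≤-reflexive (ℕ.+-comm n (toℕ u))) (ℕ.≤-trans (ℕ.m≤n+m _ n) (ℕ.m≤m+n _ _))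
  step-gap≤n {u} (shifted _ _) (shifted _ _) = ∣-∣-≤ (n ℕ.+ toℕ u) (n ℕ.+ toℕ u) (ℕ.m≤m+n _ _) (ℕ.m≤m+n _ _)
  step-gap≤n {u} (beyond _) (beyond _) = ∣-∣-≤ (K ℕ.+ toℕ u) (K ℕ.+ toℕ u) (ℕ.m≤m+n _ _) (ℕ.m≤m+n _ _)
  step-gap≤n (beyond h≤u)    (resting u<h _) = contradiction u<h (ℕ.≤⇒≯ h≤u)
  step-gap≤n (beyond h≤u)    (shifted u<h _) = contradiction u<h (ℕ.≤⇒≯ h≤u)
  step-gap≤n (resting u<h _) (beyond h≤u)    = contradiction u<h (ℕ.≤⇒≯ h≤u)
  step-gap≤n (shifted u<h _) (beyond h≤u)    = contradiction u<h (ℕ.≤⇒≯ h≤u)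

  place-injective : ∀ {u v b b′ x y} → Place u b x → Place v b′ y → x ≡ y → u ≡ v
  place-injective (resting _ _) (resting _ _) eq = Fin.toℕ-injective eq
  place-injective (shifted _ _) (shifted _ _) eq = Fin.toℕ-injective (ℕ.+-cancelˡ-≡ n _ _ eq)
  place-injective (beyond _)    (beyond _)    eq = Fin.toℕ-injective (ℕ.+-cancelˡ-≡ K _ _ eq)
  place-injective {u} (resting _ _) (shifted _ _) eq =
    contradiction (Fin.toℕ<n u) (ℕ.≤⇒≯ (ℕ.≤-trans (ℕ.m≤m+n n _) (ℕ.≤-reflexive (≡.sym eq))))
  place-injective {v = v} (shifted _ _) (resting _ _) eq =
    contradiction (Fin.toℕ<n v) (ℕ.≤⇒≯ (ℕ.≤-trans (ℕ.m≤m+n n _) (ℕ.≤-reflexive eq)))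
  place-injective p@(resting u<h _) (beyond _) eq =
    contradiction (helper-place<K u<h p) (ℕ.≤⇒≯ (ℕ.≤-trans (ℕ.m≤m+n K _) (ℕ.≤-reflexive (≡.sym eq))))
  place-injective p@(shifted u<h _) (beyond _) eq =
    contradiction (helper-place<K u<h p) (ℕ.≤⇒≯ (ℕ.≤-trans (ℕ.m≤m+n K _) (ℕ.≤-reflexive (≡.sym eq))))
  place-injective (beyond _) p@(resting u<h _) eq =
    contradiction (helper-place<K u<h p) (ℕ.≤⇒≯ (ℕ.≤-trans (ℕ.m≤m+n K _) (ℕ.≤-reflexive eq)))
  place-injective (beyond _) p@(shifted u<h _) eq =
    contradiction (helper-place<K u<h p) (ℕ.≤⇒≯ (ℕ.≤-trans (ℕ.m≤m+n K _) (ℕ.≤-reflexive eq)))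

  shifted-gap≤K : ∀ {u v b′ x y} → toℕ u ℕ.< h → h ℕ.≤ toℕ v → Place u true x → Place v b′ y → ∣ x - y ∣ ℕ.≤ K
  shifted-gap≤K {u} {v} u<h h≤v p@(shifted _ _) (beyond _) =
    ∣-∣-≤ (n ℕ.+ toℕ u) (K ℕ.+ toℕ v) (ℕ.≤-trans (ℕ.<⇒≤ (helper-place<K u<h p)) (ℕ.m≤n+m _ _))
          (ℕ.≤-trans (ℕ.≤-reflexive (ℕ.+-comm K (toℕ v))) (ℕ.+-monoˡ-≤ K (ℕ.≤-trans (u≤n v) (ℕ.m≤m+n n (toℕ u)))))
  shifted-gap≤K u<h h≤v (beyond h≤u) q             = contradiction u<h (ℕ.≤⇒≯ h≤u)
  shifted-gap≤K u<h h≤v p (resting v<h _)          = contradiction v<h (ℕ.≤⇒≯ h≤v)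
  shifted-gap≤K u<h h≤v p (shifted v<h _)          = contradiction v<h (ℕ.≤⇒≯ h≤v)

  resting-gap>K : ∀ {u v b′ x y} → toℕ u ℕ.< h → h ℕ.≤ toℕ v → Place u false x → Place v b′ y → K ℕ.< ∣ x - y ∣
  resting-gap>K {u} {v} u<h h≤v (resting _ _) (beyond _) = ℕ.+-cancelˡ-< (toℕ u) _ _ (begin-strict
    toℕ u ℕ.+ K                            ≡⟨ ℕ.+-comm (toℕ u) K ⟩
    K ℕ.+ toℕ u                            <⟨ ℕ.+-monoʳ-< K (ℕ.<-≤-trans u<h h≤v) ⟩
    K ℕ.+ toℕ v                            ≤⟨ ℕ.m≤n+m∸n _ (toℕ u) ⟩
    toℕ u ℕ.+ (K ℕ.+ toℕ v ∸ toℕ u)        ≤⟨ ℕ.+-monoʳ-≤ (toℕ u) (ℕ.m∸n≤∣m-n∣ (K ℕ.+ toℕ v) (toℕ u)) ⟩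
    toℕ u ℕ.+ ∣ K ℕ.+ toℕ v - toℕ u ∣      ≡⟨ ≡.cong (toℕ u ℕ.+_) (ℕ.∣-∣-comm _ (toℕ u)) ⟩
    toℕ u ℕ.+ ∣ toℕ u - K ℕ.+ toℕ v ∣      ∎)
    where open ℕ.≤-Reasoning
  resting-gap>K u<h h≤v (beyond h≤u) q             = contradiction u<h (ℕ.≤⇒≯ h≤u)
  resting-gap>K u<h h≤v p (resting v<h _)          = contradiction v<h (ℕ.≤⇒≯ h≤v)
  resting-gap>K u<h h≤v p (shifted v<h _)          = contradiction v<h (ℕ.≤⇒≯ h≤v)

-- Consequences of a successful reception

does⇒ : {A : Set} (a? : Dec A) → does a? ≡ true → A
does⇒ (yes a) _ = a

T⇒≡ : ∀ {b} → T b → b ≡ true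
T⇒≡ = Equivalence.to T-≡

≡⇒T : ∀ {b} → b ≡ true → T b
≡⇒T = Equivalence.from T-≡

¬T⇒≡ : ∀ {b} → ¬ T b → b ≡ false
¬T⇒≡ {true}  ¬t = contradiction _ ¬t
¬T⇒≡ {false} ¬t = ≡.refl

≢⇒true : ∀ {b} → b ≢ false → b ≡ true
≢⇒true {true}  _   = ≡.refl
≢⇒true {false} b≢f = contradiction ≡.refl b≢f

false≢true : ∀ {b} → b ≡ false → b ≢ true
false≢true ≡.refl ()

mapMaybe-∈ : {A B : Set} (f : A → Maybe B) {x : A} {y : B} {xs : List A} →
  x ∈ xs → f x ≡ just y → y ∈ mapMaybe f xs
mapMaybe-∈ f {xs = x ∷ xs} (here ≡.refl) fx≡y with f x
mapMaybe-∈ f (here ≡.refl) ≡.refl | just y = here ≡.refl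
mapMaybe-∈ f {xs = z ∷ xs} (there x∈xs) fx≡y with f z
... | just _  = there (mapMaybe-∈ f x∈xs fx≡y)
... | nothing = mapMaybe-∈ f x∈xs fx≡y

mapMaybe-∈⁻ : {A B : Set} (f : A → Maybe B) {y : B} (xs : List A) →
  y ∈ mapMaybe f xs → ∃[ x ] f x ≡ just y
mapMaybe-∈⁻ f (x ∷ xs) y∈ with f x in eq
mapMaybe-∈⁻ f (x ∷ xs) (here ≡.refl) | just _  = x , eq
mapMaybe-∈⁻ f (x ∷ xs) (there y∈)    | just _  = mapMaybe-∈⁻ f xs y∈
mapMaybe-∈⁻ f (x ∷ xs) y∈            | nothing = mapMaybe-∈⁻ f xs y∈

module _ {R : Reals} {n : ℕ} {r d Vmax : Reals.ℝ R} (𝓟 : Geocast.Protocol R n r d Vmax) where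

  open Geocast R n r d Vmax
  open Execution 𝓟
  open Protocol 𝓟

  sends : Maybe (Action State Msg) → Bool
  sends x = is-just (x >>= send)

  -- All that the probability estimates use about a reception of I. The field `sole` is the absence
  -- of a collision; the reception rule also counts the receiver's own transmissions, whence
  -- `distinct`.
  record Hears (c : Config) (w : World) (as : Draws) (u : Node) : Set where
    field
      speaker  : Node
      awake    : active c u ≡ true
      near     : does (near? c u speaker) ≡ true
      speaks   : sends (lookup as speaker) ≡ true
      knows    : informed w speaker ≡ true
      distinct : speaker ≢ u
      sole     : ∀ v → does (near? c u v) ≡ true → sends (lookup as v) ≡ true → v ≡ speaker

  hears : ∀ c w as u → maybe′ proj₁ false (received c w as u) ≡ true → Hears c w as u
  hears c w as u got with active c u in act | transmissionsAround c as u in around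
  ... | true | (v , m) ∷ [] with v Fin.≟ u
  ...   | no v≢u = record
    { speaker = v ; awake = act ; near = proj₁ heard ; speaks = proj₂ heard
    ; knows = got ; distinct = v≢u ; sole = sole }
    where
    transmission : Node → Maybe (Node × Msg)
    transmission v = if does (near? c u v) then Maybe.map (v ,_) (lookup as v >>= send) else nothing

    origin : ∀ {y} v → transmission v ≡ just y → v ≡ proj₁ y × does (near? c u v) ≡ true × sends (lookup as v) ≡ true
    origin v eq with does (near? c u v) | lookup as v >>= send
    origin v ≡.refl | true | just _ = ≡.refl , ≡.refl , ≡.refl

    heard : does (near? c u v) ≡ true × sends (lookup as v) ≡ true
    heard with mapMaybe-∈⁻ transmission (allFin n) (≡.subst ((v , m) ∈_) (≡.sym around) (here ≡.refl))
    ... | x , eq with origin x eq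
    ...   | ≡.refl , rest = rest

    audible : ∀ v → does (near? c u v) ≡ true → sends (lookup as v) ≡ true → ∃[ m′ ] transmission v ≡ just (v , m′)
    audible v near speaks with does (near? c u v) | lookup as v >>= send
    audible v near speaks | true | just m′ = m′ , ≡.refl

    sole : ∀ v′ → does (near? c u v′) ≡ true → sends (lookup as v′) ≡ true → v′ ≡ v
    sole v′ near speaks with audible v′ near speaks
    ... | m′ , eq with ≡.subst ((v′ , m′) ∈_) around (mapMaybe-∈ transmission (∈-allFin v′) eq)
    ...   | here ≡.refl = ≡.refl

  deaf : ∀ c w as u → active c u ≡ false → maybe′ proj₁ false (received c w as u) ≡ false
  deaf c w as u inactive rewrite inactive = ≡.refl

-- The adaptive strategy of the adversary

module Strategy (R : Reals) (n : ℕ) (r d Vmax : Reals.ℝ R)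
                (𝓟 : Geocast.Protocol R n r d Vmax)
                (scaling : LatticePoints.Scale R n r d Vmax)
                (h m M α : ℕ) (h+m≡n : h ℕ.+ m ≡ n) (1<h : 1 ℕ.< h)
                (threshold : HitRates.Threshold R M) where

  open Reals R hiding (zero)
  open RealFunctions R
  open OrderedFieldProperties R
  open ≤-Reasoning
  open ExpectationProperties R using
    ( ∏; ∏-nonneg; ∏-mono-≤; ∏-1≤; ∏-block; block; block⇒<; block⇒≥; push; Possible; Independent
    ; 𝔼-+; 𝔼-cong; 𝔼-const; 𝔼-nonneg; 𝔼-push; push-isDistribution; point-isDistribution
    ; 𝔼-joint-+; 𝔼-joint-*; 𝔼-joint-∏; 𝔼-joint-const; 𝔼-joint-marginal; 𝔼-joint-mono-≤
    ; indicator-mono; 0≤indicator; indicator≤1; indicator-not)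
  open LatticePoints R
  open Scale scaling
  open HitRates R using (module Threshold)
  open Threshold threshold
  open Geocast R n r d Vmax
  open Execution 𝓟
  open Protocol 𝓟

  h≤n : h ℕ.≤ n
  h≤n = ℕ.≤-trans (ℕ.m≤m+n h m) (ℕ.≤-reflexive h+m≡n)

  open Placement n h K h≤n 2n≤K

  Helper : Node → Set
  Helper u = toℕ u ℕ.< h

  1<n : 1 ℕ.< n
  1<n = ℕ.<-≤-trans 1<h h≤n

  s : Node
  s = fromℕ< (ℕ.<-trans ℕ.z<s 1<n)

  toℕ-s : toℕ s ≡ 0
  toℕ-s = Fin.toℕ-fromℕ< _

  s-helper : Helper s
  s-helper = ≡.subst (ℕ._< h) (≡.sym toℕ-s) (ℕ.<-trans ℕ.z<s 1<h)

  data Phase : Set where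
    gather : Phase
    -- i more slots of silence before the attack, j nodes still to be covered
    wait   : (i j : ℕ) → Phase

  HelpersCovered : (Node → Bool) → Set
  HelpersCovered cov = ∀ u → Helper u → T (cov u)

  helpersCovered? : ∀ cov → Dec (HelpersCovered cov)
  helpersCovered? cov = Fin.all? λ u → (toℕ u ℕ.<? h) →-dec T? (cov u)

  -- With j nodes left, the attacked one has number n - j, so the nodes from h on are attacked in
  -- increasing order. The equation with a sum avoids truncated subtraction.
  TargetCovered : ℕ → (Node → Bool) → Set
  TargetCovered j cov = ∀ u → toℕ u ℕ.+ j ≡ n → T (cov u)

  targetCovered? : ∀ j cov → Dec (TargetCovered j cov)
  targetCovered? j cov = Fin.all? λ u → (toℕ u ℕ.+ j ℕ.≟ n) →-dec T? (cov u)

  next-phase : Phase → (Node → Bool) → Phase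
  next-phase gather               cov = if does (helpersCovered? cov) then wait α m else gather
  next-phase (wait (suc i) j)     cov = wait i j
  next-phase (wait zero zero)     cov = wait zero zero
  next-phase (wait zero (suc j))  cov =
    if does (targetCovered? (suc j) cov) then wait α j else wait zero (suc j)

  crowding : ∀ {p} → c′ < p ⊎ p < c → Node → Bool
  crowding (inj₁ _) u = true
  crowding (inj₂ _) u = toℕ u ≡ᵇ 0

  -- Read before the slot boundary. Attacks never fall in slot 0, and at a later boundary an awake
  -- node keeps its state, so the source draws its action from this very state.
  sourceState : World → State
  sourceState v = fromMaybe (boot s) (state v s)

  rate : ℕ → World → ℝ
  rate t v = prTransmit t (sourceState v)

  shift : Phase → ℕ → World → Node → Bool
  shift gather           t v = λ _ → false
  shift (wait (suc i) j) t v = λ _ → false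
  -- Cotransitivity replaces the undecidable test of p against c. Where both alternatives hold,
  -- either choice serves.
  shift (wait zero j)    t v = crowding (<-cotrans c′<c (rate t v))

  awake? : Phase → Node → Bool
  -- Only nodes active at time t₁ are targets, so all nodes are awake here. The outer ones still
  -- receive nothing, since no helper is shifted.
  awake? gather           u = true
  awake? (wait (suc i) j) u = toℕ u <ᵇ h
  awake? (wait zero j)    u = (toℕ u <ᵇ h) ∨ (toℕ u ℕ.+ j ≡ᵇ n)

  layout : (Node → Bool) → (Node → Bool) → Config
  layout sh act = record
    { pos     = λ u → point η 0<η (coordinate sh u)
    ; active  = act
    ; near?   = λ u v → point-within? η 0<η K Kη≈r (coordinate sh u) (coordinate sh v)
    ; inArea? = λ u v → yes (point-within η 0<η (coordinate sh u) (coordinate sh v)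
        (≤-trans (*-monoˡ-≤ (<⇒≤ 0<η) (fromℕ-mono-≤ (gap≤K+n (place sh u) (place sh v)))) [K+n]η≤d))
    }

  configure : Phase → ℕ → World → Config
  configure φ t v = layout (shift φ t v) (awake? φ)

  -- The slot boundary consults source and t₁ only, which breaks the circularity
  -- between the adversary and the worlds that it reacts to.
  A₀ : Adversary
  A₀ = record { source = s ; t₁ = 0 ; move = λ _ → configure gather 0 blank }

  mutual
    phase : History → Phase
    phase []       = gather
    phase (as ∷ t) = next-phase (phase t) (covered (past (as ∷ t)))

    past : History → World
    past []       = blank
    past (as ∷ t) = play (config t) as (present t)

    config : History → Config
    config t = configure (phase t) (length t) (past t)

    present : History → World
    present t = boundary A₀ (length t) (config t) (past t)

  A : Adversary
  A = record { source = s ; t₁ = 0 ; move = config }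

  -- `A` and `A₀` agree on the source and on t₁, so the worlds arising under `A` are those from
  -- which its moves were computed.
  after≡past : ∀ t → after A t ≡ past t
  at≡present : ∀ t → at A t ≡ present t
  after≡past []       = ≡.refl
  after≡past (as ∷ t) = ≡.cong (play (config t) as) (at≡present t)
  at≡present t = ≡.cong (boundary A₀ (length t) (config t)) (after≡past t)

  -- Legality and the invariants of the phases

  helper-awake : ∀ φ {u} → Helper u → awake? φ u ≡ true
  helper-awake gather           u<h = ≡.refl
  helper-awake (wait (suc i) j) u<h = T⇒≡ (ℕ.<⇒<ᵇ u<h)
  helper-awake (wait zero j)    u<h rewrite T⇒≡ (ℕ.<⇒<ᵇ u<h) = ≡.refl

  others-asleep : ∀ {i j u} → h ℕ.≤ toℕ u → (i ≡ 0 → toℕ u ℕ.+ j ≢ n) → awake? (wait i j) u ≡ false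
  others-asleep {zero} {j} {u} h≤u u+j≢n
    rewrite ¬T⇒≡ {toℕ u <ᵇ h} (λ t → ℕ.≤⇒≯ h≤u (ℕ.<ᵇ⇒< _ _ t))
          = ¬T⇒≡ λ t → u+j≢n ≡.refl (ℕ.≡ᵇ⇒≡ _ _ t)
  others-asleep {suc i} h≤u u+j≢n = ¬T⇒≡ λ t → ℕ.≤⇒≯ h≤u (ℕ.<ᵇ⇒< _ _ t)

  target-awake : ∀ {j u} → toℕ u ℕ.+ j ≡ n → awake? (wait 0 j) u ≡ true
  target-awake {j} {u} u+j≡n rewrite T⇒≡ (ℕ.≡⇒≡ᵇ _ _ u+j≡n) = ∨-zeroʳ _

  near⇒gap : ∀ {sh act u v} → does (near? (layout sh act) u v) ≡ true → ∣ coordinate sh u - coordinate sh v ∣ ℕ.≤ K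
  near⇒gap {sh} {act} {u} {v} near = does⇒ (∣ coordinate sh u - coordinate sh v ∣ ℕ.≤? K) near

  gap⇒near : ∀ {sh act u v} → ∣ coordinate sh u - coordinate sh v ∣ ℕ.≤ K → does (near? (layout sh act) u v) ≡ true
  gap⇒near {sh} {act} {u} {v} gap≤K = dec-true (∣ coordinate sh u - coordinate sh v ∣ ℕ.≤? K) gap≤K

  gap⇒within : ∀ {sh act u v} → ∣ coordinate sh u - coordinate sh v ∣ ℕ.≤ K →
    Within r (pos (layout sh act) u) (pos (layout sh act) v)
  gap⇒within {sh} {act} {u} {v} gap≤K = does⇒ (near? (layout sh act) u v) (gap⇒near {sh} {act} {u} {v} gap≤K)

  gap-sym : ∀ sh u v → ∣ coordinate sh u - coordinate sh v ∣ ≡ ∣ coordinate sh v - coordinate sh u ∣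
  gap-sym sh u v = ℕ.∣-∣-comm (coordinate sh u) (coordinate sh v)

  resting-far : ∀ {sh act u v} → Helper v → h ℕ.≤ toℕ u → sh v ≡ false → does (near? (layout sh act) u v) ≢ true
  resting-far {sh} {act} {u} {v} v<h h≤u still near = ℕ.<⇒≱
    (resting-gap>K v<h h≤u (≡.subst (λ b → Place v b (coordinate sh v)) still (place sh v)) (place sh u))
    (≡.subst (ℕ._≤ K) (gap-sym sh u v) (near⇒gap {sh} {act} {u} {v} near))

  shifted-gap : ∀ {sh u v} → Helper v → h ℕ.≤ toℕ u → sh v ≡ true → ∣ coordinate sh v - coordinate sh u ∣ ℕ.≤ K
  shifted-gap {sh} {u} {v} v<h h≤u moved =
    shifted-gap≤K v<h h≤u (≡.subst (λ b → Place v b (coordinate sh v)) moved (place sh v)) (place sh u)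

  source-crowds : ∀ {p} (dec : c′ < p ⊎ p < c) → crowding dec s ≡ true
  source-crowds (inj₁ _) = ≡.refl
  source-crowds (inj₂ _) = T⇒≡ (ℕ.≡⇒≡ᵇ _ _ toℕ-s)

  legal : Legal A
  legal = record
    { distinct = λ {t} _ u v u≢v same → u≢v (place-injective (place (sh t) u) (place (sh t) v)
        (point-injective η 0<η {coordinate (sh t) u} {coordinate (sh t) v} same))
    ; speed = λ {as} {t} _ u → point-within η 0<η (coordinate (sh t) u) (coordinate (sh (as ∷ t)) u)
        (≤-trans (*-monoˡ-≤ (<⇒≤ 0<η) (fromℕ-mono-≤ (step-gap≤n (place (sh t) u) (place (sh (as ∷ t)) u)))) nη≤V)
    ; source-active = λ {t} _ _ → helper-awake (phase t) s-helper
    }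
    where
    sh : History → Node → Bool
    sh t = shift (phase t) (length t) (past t)

  -- The negation in the gathering phase supplies an uncovered helper. In `wait i j` the numbers
  -- from n - j on are the uncovered nodes, so j > 0 supplies one as well. Both connectivity and
  -- unsolvedness rest on these witnesses.
  PhaseInvariant : Phase → World → Set
  PhaseInvariant gather     w =
    ¬ HelpersCovered (covered w) ×
    (∀ u → h ℕ.≤ toℕ u → covered w u ≡ false × informed w u ≡ false)
  PhaseInvariant (wait i j) w =
    i ℕ.≤ α × j ℕ.≤ m × HelpersCovered (covered w) ×
    (∀ u → h ℕ.≤ toℕ u → n ℕ.≤ toℕ u ℕ.+ j → covered w u ≡ false) ×
    (∀ u → h ℕ.≤ toℕ u → toℕ u ℕ.+ j ℕ.< n → T (covered w u))

  -- Helpers never sleep, so for them being covered and holding I agree. For the other nodes this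
  -- fails once they are switched off.
  record Invariant (φ : Phase) (w : World) : Set where
    field
      helper-informed : ∀ u → Helper u → informed w u ≡ covered w u
      source-covered  : covered w s ≡ true
      all-targets     : ∀ u → target w u ≡ true
      phase-invariant : PhaseInvariant φ w

  open Invariant public

  T-∨ˡ : ∀ {a} b → T a → T (a ∨ b)
  T-∨ˡ {true} b t = t

  -- Resting helpers are out of range of the outer nodes, and no outer node holds I, so an outer
  -- node has no possible speaker.
  gather-silent : ∀ t v w as u → PhaseInvariant gather w → h ℕ.≤ toℕ u →
    maybe′ proj₁ false (received (configure gather t v) w as u) ≡ false
  gather-silent t v w as u (_ , far) h≤u = ¬T⇒≡ λ got →
    let open Hears (hears 𝓟 (configure gather t v) w as u (T⇒≡ got)) in
    case-speaker speaker near knows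
    where
    case-speaker : ∀ x → does (near? (configure gather t v) u x) ≡ true → informed w x ≢ true
    case-speaker x near knows with ℕ.<-≤-connex (toℕ x) h
    ... | inj₁ x<h = contradiction near (resting-far {λ _ → false} {λ _ → true} {u} {x} x<h h≤u ≡.refl)
    ... | inj₂ h≤x = false≢true (proj₂ (far x h≤x)) knows

  wait-silent : ∀ i j t v w as u → h ℕ.≤ toℕ u → (i ≡ 0 → toℕ u ℕ.+ j ≢ n) →
    maybe′ proj₁ false (received (configure (wait i j) t v) w as u) ≡ false
  wait-silent i j t v w as u h≤u u+j≢n =
    deaf 𝓟 (configure (wait i j) t v) w as u (others-asleep {i} {j} {u} h≤u u+j≢n)

  h≤target : ∀ {j} (u : Node) → j ℕ.≤ m → n ℕ.≤ toℕ u ℕ.+ j → h ℕ.≤ toℕ u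
  h≤target {j} u j≤m n≤u+j = ℕ.+-cancelʳ-≤ m h (toℕ u) (ℕ.≤-trans (ℕ.≤-reflexive h+m≡n)
    (ℕ.≤-trans n≤u+j (ℕ.+-monoʳ-≤ (toℕ u) j≤m)))

  phase-step : ∀ φ t v w as → PhaseInvariant φ w →
    PhaseInvariant (next-phase φ (covered (play (configure φ t v) as w))) (play (configure φ t v) as w)
  phase-step gather t v w as inv = after-gathering (helpersCovered? (covered w₁))
    where
    w₁ = play (configure gather t v) as w
    after-gathering : (dec : Dec (HelpersCovered (covered w₁))) →
      PhaseInvariant (if does dec then wait α m else gather) w₁
    after-gathering (yes all) = ℕ.≤-refl , ℕ.≤-refl , all ,
        (λ u h≤u _ → ≡.cong₂ _∨_ (proj₁ (proj₂ inv u h≤u)) (gather-silent t v w as u inv h≤u)) ,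
        (λ u h≤u u+m<n → contradiction u+m<n (ℕ.≤⇒≯ (ℕ.≤-trans (ℕ.≤-reflexive (≡.sym h+m≡n)) (ℕ.+-monoˡ-≤ m h≤u))))
    after-gathering (no ¬all) = ¬all , λ u h≤u →
        ≡.cong₂ _∨_ (proj₁ (proj₂ inv u h≤u)) (gather-silent t v w as u inv h≤u) ,
        ≡.cong₂ _∨_ (proj₂ (proj₂ inv u h≤u)) (gather-silent t v w as u inv h≤u)
  phase-step (wait (suc i) j) t v w as (i≤α , j≤m , all , ahead , behind) =
    ℕ.≤-trans (ℕ.n≤1+n i) i≤α , j≤m , (λ u u<h → T-∨ˡ _ (all u u<h)) ,
    (λ u h≤u n≤u+j → ≡.cong₂ _∨_ (ahead u h≤u n≤u+j) (wait-silent (suc i) j t v w as u h≤u λ ())) ,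
    (λ u h≤u u+j<n → T-∨ˡ _ (behind u h≤u u+j<n))
  phase-step (wait zero zero) t v w as (i≤α , j≤m , all , ahead , behind) =
    i≤α , j≤m , (λ u u<h → T-∨ˡ _ (all u u<h)) ,
    (λ u h≤u n≤u → contradiction (Fin.toℕ<n u) (ℕ.≤⇒≯ (ℕ.≤-trans n≤u (ℕ.≤-reflexive (ℕ.+-identityʳ (toℕ u)))))) ,
    (λ u h≤u u+j<n → T-∨ˡ _ (behind u h≤u u+j<n))
  phase-step (wait zero (suc j)) t v w as (i≤α , j<m , all , ahead , behind)
    = after-attack (targetCovered? (suc j) (covered w₁))
    where
    w₁ = play (configure (wait zero (suc j)) t v) as w
    after-attack : (dec : Dec (TargetCovered (suc j) (covered w₁))) →
      PhaseInvariant (if does dec then wait α j else wait zero (suc j)) w₁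
    after-attack (yes hit) = ℕ.≤-refl , ℕ.<⇒≤ j<m , (λ u u<h → T-∨ˡ _ (all u u<h)) ,
        (λ u h≤u n≤u+j → ≡.cong₂ _∨_ (ahead u h≤u (ℕ.≤-trans n≤u+j (ℕ.+-monoʳ-≤ (toℕ u) (ℕ.n≤1+n j))))
          (wait-silent 0 (suc j) t v w as u h≤u λ _ u+j≡n →
            ℕ.<⇒≢ (ℕ.≤-<-trans n≤u+j (ℕ.+-monoʳ-< (toℕ u) (ℕ.n<1+n j))) (≡.sym u+j≡n))) ,
        newly
      where
      newly : ∀ u → h ℕ.≤ toℕ u → toℕ u ℕ.+ j ℕ.< n → T (covered w₁ u)
      newly u h≤u u+j<n with ℕ.m≤n⇒m<n∨m≡n (ℕ.≤-trans (ℕ.≤-reflexive (ℕ.+-suc (toℕ u) j)) u+j<n)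
      ... | inj₁ u+j<n = T-∨ˡ _ (behind u h≤u u+j<n)
      ... | inj₂ u+j≡n = hit u u+j≡n
    after-attack (no miss) = i≤α , j<m , (λ u u<h → T-∨ˡ _ (all u u<h)) , missed , (λ u h≤u u+j<n → T-∨ˡ _ (behind u h≤u u+j<n))
      where
      missed : ∀ u → h ℕ.≤ toℕ u → n ℕ.≤ toℕ u ℕ.+ suc j → covered w₁ u ≡ false
      missed u h≤u n≤u+j with ℕ.m≤n⇒m<n∨m≡n n≤u+j
      ... | inj₁ n<u+j = ≡.cong₂ _∨_ (ahead u h≤u n≤u+j)
            (wait-silent 0 (suc j) t v w as u h≤u λ _ u+j≡n → ℕ.<⇒≢ n<u+j (≡.sym u+j≡n))
      -- Numbers identify nodes, so covering `u` alone would already make `TargetCovered` true.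
      ... | inj₂ n≡u+j = ¬T⇒≡ λ hit → miss λ u′ u′+j≡n →
            ≡.subst (λ x → T (covered w₁ x))
              (Fin.toℕ-injective (ℕ.+-cancelʳ-≡ (suc j) _ _ (≡.trans (≡.sym n≡u+j) (≡.sym u′+j≡n)))) hit

  phase-activation : ∀ φ c w → PhaseInvariant φ w → PhaseInvariant φ (activation c w)
  phase-activation gather     c w (¬all , far) = ¬all , λ u h≤u → proj₁ (far u h≤u) ,
    ≡.trans (≡.cong (active c u ∧_) (proj₂ (far u h≤u))) (∧-zeroʳ (active c u))
  phase-activation (wait i j) c w inv = inv

  invariant : ∀ t → Invariant (phase t) (present t)
  invariant [] = record
    { helper-informed = λ u _ → ≡.refl
    ; source-covered  = ≡.cong (_∨ false) (dec-true (s Fin.≟ s) ≡.refl)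
    ; all-targets     = λ u → ≡.refl
    -- Node 1 is a helper other than the source, so the gathering phase is not over at the start.
    ; phase-invariant = (λ all → 1-uncovered (all one (≡.subst (ℕ._< h) (≡.sym toℕ-one) 1<h))) ,
        λ u h≤u → ≡.cong (_∨ false) (u≢s u h≤u) , ≡.cong (_∨ false) (u≢s u h≤u)
    }
    where
    one : Node
    one = fromℕ< 1<n
    toℕ-one : toℕ one ≡ 1
    toℕ-one = Fin.toℕ-fromℕ< 1<n
    1-uncovered : ¬ T (covered (present []) one)
    1-uncovered rewrite dec-false (one Fin.≟ s) (λ one≡s → ℕ.1+n≢0 (≡.trans (≡.sym toℕ-one) (≡.trans (≡.cong toℕ one≡s) toℕ-s)))
      = λ ()
    u≢s : ∀ u → h ℕ.≤ toℕ u → does (u Fin.≟ s) ≡ false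
    u≢s u h≤u = dec-false (u Fin.≟ s) λ u≡s → ℕ.<⇒≱ s-helper (≡.subst (λ x → h ℕ.≤ toℕ x) u≡s h≤u)
  invariant (as ∷ t) = record
    { helper-informed = λ u u<h → ≡.trans (≡.cong (_∧ informed (past (as ∷ t)) u) (helper-awake (phase (as ∷ t)) u<h))
                                          (≡.cong (_∨ gets u) (helper-informed inv u u<h))
    ; source-covered  = ≡.cong (_∨ gets s) (source-covered inv)
    ; all-targets     = all-targets inv
    ; phase-invariant = phase-activation (phase (as ∷ t)) (config (as ∷ t)) (past (as ∷ t))
        (phase-step (phase t) (length t) (past t) (present t) as (phase-invariant inv))
    }
    where
    inv = invariant t
    gets : Node → Bool
    gets u = maybe′ proj₁ false (received (config t) (present t) as u)

  -- Connectivity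

  target-node : ∀ {j} → 0 ℕ.< j → j ℕ.≤ m → ∃[ u ] toℕ {n} u ℕ.+ j ≡ n
  target-node {j} 0<j j≤m = fromℕ< n-j<n , ≡.trans (≡.cong (ℕ._+ j) (Fin.toℕ-fromℕ< n-j<n)) (ℕ.m∸n+n≡m j≤n)
    where
    j≤n : j ℕ.≤ n
    j≤n = ℕ.≤-trans j≤m (ℕ.≤-trans (ℕ.m≤n+m m h) (ℕ.≤-reflexive h+m≡n))
    n-j<n : n ∸ j ℕ.< n
    n-j<n = ℕ.∸-monoʳ-< 0<j j≤n

  target-beyond : ∀ {j} (u : Node) → j ℕ.≤ m → toℕ u ℕ.+ j ≡ n → h ℕ.≤ toℕ u
  target-beyond u j≤m u+j≡n = h≤target u j≤m (ℕ.≤-reflexive (≡.sym u+j≡n))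

  finished-solved : ∀ {i w} → PhaseInvariant (wait i 0) w → Solved w
  finished-solved (_ , _ , all , _ , behind) u _ with ℕ.<-≤-connex (toℕ u) h
  ... | inj₁ u<h = all u u<h
  ... | inj₂ h≤u = behind u h≤u (≡.subst (ℕ._< n) (≡.sym (ℕ.+-identityʳ (toℕ u))) (Fin.toℕ<n u))

  uncovered-unsolved : ∀ {φ w} → Invariant φ w → ∃[ u ] covered w u ≡ false → ¬ Solved w
  uncovered-unsolved inv (u , u-uncovered) solved =
    false≢true u-uncovered (T⇒≡ (solved u (≡⇒T (all-targets inv u))))

  target-uncovered : ∀ {i j w} → PhaseInvariant (wait i (suc j)) w →
    ∃[ u ] (toℕ u ℕ.+ suc j ≡ n × h ℕ.≤ toℕ u × covered w u ≡ false)
  target-uncovered {j = j} (_ , j<m , _ , ahead , _) =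
    let u , u+j≡n = target-node ℕ.z<s j<m
        h≤u = target-beyond u j<m u+j≡n
    in u , u+j≡n , h≤u , ahead u h≤u (ℕ.≤-reflexive (≡.sym u+j≡n))

  helper-uncovered : ∀ {w} → PhaseInvariant gather w → ∃[ u ] (Helper u × covered w u ≡ false)
  helper-uncovered {w} (¬all , _) =
    let u , ¬covered = Fin.¬∀⟶∃¬ n _ (λ u → (toℕ u ℕ.<? h) →-dec T? (covered w u)) ¬all
    in u , helper u ¬covered , ¬T⇒≡ λ t → ¬covered λ _ → t
    where
    helper : ∀ u → ¬ (Helper u → T (covered w u)) → Helper u
    helper u ¬covered with toℕ u ℕ.<? h
    ... | yes u<h = u<h
    ... | no  u≮h = ⊥-elim (¬covered λ u<h → contradiction u<h u≮h)

  covered-persists : ∀ as t u → covered (present t) u ≡ true → covered (present (as ∷ t)) u ≡ true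
  covered-persists as t u cov = ≡.cong (_∨ maybe′ proj₁ false (received (config t) (present t) as u)) cov

  module _ (ω : ℕ → Draws) where

    private
      ph : ℕ → Phase
      ph t = phase (prefix ω t)

      cov : ℕ → Node → Bool
      cov t = covered (present (prefix ω t))

      inv : ∀ t → Invariant (ph t) (present (prefix ω t))
      inv t = invariant (prefix ω t)

      at-eq : ∀ t → at A (prefix ω t) ≡ present (prefix ω t)
      at-eq t = at≡present (prefix ω t)

    attack-comes : ∀ i {j} t → ph t ≡ wait i j → ph (i ℕ.+ t) ≡ wait 0 j
    attack-comes zero    t eq = eq
    attack-comes (suc i) {j} t eq = ≡.subst (λ k → ph k ≡ wait 0 j) (ℕ.+-suc i t)
      (attack-comes i (suc t) (≡.cong (λ φ → next-phase φ (covered (past (prefix ω (suc t))))) eq))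

    -- An attack ends only when its target is covered. Hence the link to the source lasts as long as
    -- connectivity asks, whatever β is.
    attack-persists : ∀ k {j u} t → toℕ u ℕ.+ suc j ≡ n → ph t ≡ wait 0 (suc j) →
      ph (k ℕ.+ t) ≡ wait 0 (suc j) ⊎ cov (k ℕ.+ t) u ≡ true
    attack-persists zero    t u+j≡n eq = inj₁ eq
    attack-persists (suc k) {j} {u} t u+j≡n eq with attack-persists k t u+j≡n eq
    ... | inj₂ u-covered = inj₂ (covered-persists (ω (k ℕ.+ t)) (prefix ω (k ℕ.+ t)) u u-covered)
    ... | inj₁ attacking = decide (targetCovered? (suc j) later) (≡.cong (λ φ → next-phase φ later) attacking)
      where
      later : Node → Bool
      later = covered (past (prefix ω (suc k ℕ.+ t)))
      decide : (dec : Dec (TargetCovered (suc j) later)) →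
        ph (suc k ℕ.+ t) ≡ (if does dec then wait α j else wait 0 (suc j)) →
        ph (suc k ℕ.+ t) ≡ wait 0 (suc j) ⊎ cov (suc k ℕ.+ t) u ≡ true
      decide (yes hit) _  = inj₂ (T⇒≡ (hit u u+j≡n))
      decide (no  _)   eq = inj₁ eq

    attack-link : ∀ {j u} t → toℕ u ℕ.+ suc j ≡ n → h ℕ.≤ toℕ u → ph t ≡ wait 0 (suc j) →
      active (config (prefix ω t)) s ≡ true × active (config (prefix ω t)) u ≡ true ×
      Neighbours (config (prefix ω t)) s u
    attack-link {j} {u} t u+j≡n h≤u eq =
      helper-awake (ph t) s-helper ,
      ≡.trans (≡.cong (λ φ → awake? φ u) eq) (target-awake {suc j} {u} u+j≡n) ,
      (λ s≡u → ℕ.<⇒≱ s-helper (≡.subst (λ x → h ℕ.≤ toℕ x) (≡.sym s≡u) h≤u)) ,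
      gap⇒within {sh} {awake? (ph t)} {s} {u} (shifted-gap {sh} {u} {s} s-helper h≤u (s-shifted (ph t) eq))
      where
      sh = shift (ph t) (length (prefix ω t)) (past (prefix ω t))
      s-shifted : ∀ φ → φ ≡ wait 0 (suc j) → shift φ (length (prefix ω t)) (past (prefix ω t)) s ≡ true
      s-shifted _ ≡.refl = source-crowds (<-cotrans c′<c (rate (length (prefix ω t)) (past (prefix ω t))))

    helper-link : ∀ {u} t → Helper u → s ≢ u →
      active (config (prefix ω t)) s ≡ true × active (config (prefix ω t)) u ≡ true ×
      Neighbours (config (prefix ω t)) s u
    helper-link {u} t u<h s≢u = helper-awake (ph t) s-helper , helper-awake (ph t) u<h , s≢u ,
      gap⇒within {sh} {awake? (ph t)} {s} {u} (helpers-gap≤K s-helper u<h (place sh s) (place sh u))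
      where
      sh = shift (ph t) (length (prefix ω t)) (past (prefix ω t))

    source-informed : ∀ t → informed (at A (prefix ω t)) s ≡ true
    source-informed t = ≡.trans (≡.cong (λ w → informed w s) (at-eq t))
      (≡.trans (helper-informed (inv t) s s-helper) (source-covered (inv t)))

    LinkSoon : ℕ → ℕ → Set
    LinkSoon β t = ∃[ t′ ]
        (∃[ τ ] (t ℕ.≤ τ × τ ℕ.≤ t ℕ.+ α × t′ ℕ.≤ τ × τ ℕ.< t′ ℕ.+ β)) ×
        (∃[ p ] ∃[ p′ ]
          (informed (worldAt A ω t′) p ≡ true × covered (worldAt A ω t′) p′ ≡ false ×
           (∀ τ → t′ ℕ.≤ τ → τ ℕ.< t′ ℕ.+ β → covered (worldAt A ω τ) p′ ≡ false →
             active (configAt A ω τ) p ≡ true × active (configAt A ω τ) p′ ≡ true ×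
             Neighbours (configAt A ω τ) p p′)))

    connected : ∀ β → 0 ℕ.< β → ∀ t → ¬ Solved (worldAt A ω t) → LinkSoon β t
    connected β 0<β t unsolved = by-phase (ph t) ≡.refl (phase-invariant (inv t))
      where
      t′<t′+β : ∀ t′ → t′ ℕ.< t′ ℕ.+ β
      t′<t′+β t′ = ℕ.m<m+n t′ 0<β

      cov-at : ∀ t u b → cov t u ≡ b → covered (worldAt A ω t) u ≡ b
      cov-at t u b = ≡.trans (≡.cong (λ w → covered w u) (at-eq t))

      by-phase : ∀ φ → ph t ≡ φ → PhaseInvariant φ (present (prefix ω t)) → LinkSoon β t
      by-phase gather _ now =
        let u , u<h , u-uncovered = helper-uncovered {present (prefix ω t)} now
            s≢u = λ s≡u → false≢true u-uncovered (≡.subst (λ x → cov t x ≡ true) s≡u (source-covered (inv t)))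
        in t , (t , ℕ.≤-refl , ℕ.m≤m+n t α , ℕ.≤-refl , t′<t′+β t) ,
           s , u , source-informed t , cov-at t u false u-uncovered , λ τ _ _ _ → helper-link τ u<h s≢u
      by-phase (wait i zero) _ now =
        ⊥-elim (unsolved (≡.subst Solved (≡.sym (at-eq t)) (finished-solved {i} {present (prefix ω t)} now)))
      by-phase (wait i (suc j)) eq now@(i≤α , _) =
        -- The slot in which the silence runs out; `i≤α` keeps it within the window of α slots.
        let t′ = i ℕ.+ t
            attacking = attack-comes i t eq
            u , u+j≡n , h≤u , u-uncovered = target-uncovered {0} {j} {present (prefix ω t′)}
              (≡.subst (λ φ → PhaseInvariant φ (present (prefix ω t′))) attacking (phase-invariant (inv t′)))
        in t′ , (t′ , ℕ.m≤n+m t i , ℕ.≤-trans (ℕ.≤-reflexive (ℕ.+-comm i t)) (ℕ.+-monoʳ-≤ t i≤α) ,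
                 ℕ.≤-refl , t′<t′+β t′) ,
           s , u , source-informed t′ , cov-at t′ u false u-uncovered , λ τ t′≤τ _ uncovered-at-τ →
             linked τ u+j≡n h≤u
               (≡.subst (λ k → ph k ≡ wait 0 (suc j) ⊎ cov k u ≡ true) (ℕ.m∸n+n≡m t′≤τ)
                 (attack-persists (τ ∸ t′) {u = u} t′ u+j≡n attacking))
               uncovered-at-τ
        where
        linked : ∀ {u} τ → toℕ u ℕ.+ suc j ≡ n → h ℕ.≤ toℕ u →
          ph τ ≡ wait 0 (suc j) ⊎ cov τ u ≡ true → covered (worldAt A ω τ) u ≡ false →
          active (config (prefix ω τ)) s ≡ true × active (config (prefix ω τ)) u ≡ true ×
          Neighbours (config (prefix ω τ)) s u
        linked τ u+j≡n h≤u (inj₁ attacking) _ = attack-link τ u+j≡n h≤u attacking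
        linked {u} τ u+j≡n h≤u (inj₂ u-covered) uncovered =
          ⊥-elim (false≢true uncovered (cov-at τ u true u-covered))

  -- The probability of a hit

  quiet : Maybe (Action State Msg) → ℝ
  quiet x = indicator (not (sends 𝓟 x))

  silence : ℕ → State → ℝ
  silence t σ = 𝔼 (behave t σ) λ a → indicator (not (is-just (send a)))

  silence+prTransmit : ∀ t σ → silence t σ + prTransmit t σ ≈ 1#
  silence+prTransmit t σ = begin-equality
    silence t σ + prTransmit t σ
      ≈⟨ 𝔼-+ (behave t σ) _ _ ⟨
    𝔼 (behave t σ) (λ a → indicator (not (is-just (send a))) + indicator (is-just (send a)))
      ≈⟨ 𝔼-cong (behave t σ) (λ a → indicator-not (is-just (send a))) ⟩
    𝔼 (behave t σ) (λ _ → 1#)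
      ≈⟨ proj₂ (behave-isDistribution t σ) ⟩
    1# ∎

  draws-from : ℕ → Maybe State → Weighted (Maybe (Action State Msg))
  draws-from t = maybe′ (λ σ → push just (behave t σ)) ((1# , nothing) ∷ [])

  draws-from-isDistribution : ∀ t x → IsDistribution (draws-from t x)
  draws-from-isDistribution t (just σ) = push-isDistribution just (behave-isDistribution t σ)
  draws-from-isDistribution t nothing  = point-isDistribution nothing

  draws-independent : ∀ t → Independent (draws A t)
  draws-independent t u = draws-from-isDistribution (length t) (state (at A t) u)

  draws≡ : ∀ t u {x} → state (present t) u ≡ x → draws A t u ≡ draws-from (length t) x
  draws≡ t u eq = ≡.cong (draws-from (length t)) (≡.trans (≡.cong (λ w → state w u) (at≡present t)) eq)

  asleep-silent : ∀ t {as} u → Possible (draws A t) as → awake? (phase t) u ≡ false → sends 𝓟 (lookup as u) ≡ false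
  -- The empty history is in the gathering phase, where nobody sleeps.
  asleep-silent (as₀ ∷ t) {as} u possible asleep = ≡.cong (sends 𝓟) (silent (≡.subst (λ D → lookup as u ∈ outcomes D)
    (draws≡ (as₀ ∷ t) u {nothing} (≡.cong (λ b → if b then just (fromMaybe (boot u) (state (past (as₀ ∷ t)) u)) else nothing) asleep))
    (possible u)))
    where
    silent : ∀ {x} → x ∈ nothing ∷ [] → x ≡ nothing
    silent (here eq) = eq

  -- A nonempty history reduces the slot boundary to `activation`; the launch belongs to slot 0,
  -- which is never an attack.
  module Attack (fair : Fair) (as₀ : Draws) (t₀ : History) (reach : Reachable A (as₀ ∷ t₀))
                (j : ℕ) (attacking : phase (as₀ ∷ t₀) ≡ wait 0 (suc j)) where

    private
      t : History
      t = as₀ ∷ t₀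

      now : PhaseInvariant (wait 0 (suc j)) (present t)
      now = ≡.subst (λ φ → PhaseInvariant φ (present t)) attacking (phase-invariant (invariant t))

      target-data = target-uncovered {0} {j} {present t} now

      u : Node
      u = proj₁ target-data

      u+j≡n : toℕ u ℕ.+ suc j ≡ n
      u+j≡n = proj₁ (proj₂ target-data)

      h≤u : h ℕ.≤ toℕ u
      h≤u = proj₁ (proj₂ (proj₂ target-data))

      u-uncovered : covered (present t) u ≡ false
      u-uncovered = proj₂ (proj₂ (proj₂ target-data))

      sh : Node → Bool
      sh = shift (phase t) (length t) (past t)

      σ : Node → State
      σ v = fromMaybe (boot v) (state (past t) v)

      helper-state : ∀ v → Helper v → state (present t) v ≡ just (σ v)
      helper-state v v<h = ≡.cong (λ b → if b then just (σ v) else nothing) (helper-awake (phase t) v<h)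

      helper-draws : ∀ v → Helper v → draws A t v ≡ push just (behave (length t) (σ v))
      helper-draws v v<h = draws≡ t v (helper-state v v<h)

      knows-I : ∀ v → Helper v → informed (at A t) v ≡ true
      knows-I v v<h = ≡.trans (≡.cong (λ w → informed w v) (at≡present t))
        (≡.trans (helper-informed (invariant t) v v<h) (T⇒≡ (proj₁ (proj₂ (proj₂ now)) v v<h)))

      at-state : ∀ v → Helper v → state (at A t) v ≡ just (σ v)
      at-state v v<h = ≡.trans (≡.cong (λ w → state w v) (at≡present t)) (helper-state v v<h)

      p e : ℝ
      p = rate (length t) (past t)
      e = silence (length t) (σ s)

      0≤e : 0# ≤ e
      0≤e = 𝔼-nonneg (proj₁ (behave-isDistribution (length t) (σ s))) λ a → 0≤indicator _

      -- Fairness equates the transmission probabilities of two informed nodes, and total mass 1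
      -- carries this over to silence.
      same-silence : ∀ v → Helper v → 𝔼 (draws A t v) quiet ≈ e
      same-silence v v<h = begin-equality
        𝔼 (draws A t v) quiet                            ≡⟨ ≡.cong (λ D → 𝔼 D quiet) (helper-draws v v<h) ⟩
        𝔼 (push just (behave (length t) (σ v))) quiet    ≈⟨ 𝔼-push just (behave (length t) (σ v)) quiet ⟩
        silence (length t) (σ v)                         ≈⟨ +-cancelʳ-≈ p (begin-equality
          silence (length t) (σ v) + p
            ≈⟨ +-congˡ (fair A legal t reach v s (σ v) (σ s) (at-state v v<h) (knows-I v v<h) (at-state s s-helper) (knows-I s s-helper)) ⟨
          silence (length t) (σ v) + prTransmit (length t) (σ v)
            ≈⟨ silence+prTransmit (length t) (σ v) ⟩
          1#
            ≈⟨ silence+prTransmit (length t) (σ s) ⟨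
          e + p ∎) ⟩
        e ∎

    hit : Draws → Bool
    hit as = does (targetCovered? (suc j) (covered (play (config t) as (present t))))

    private
      heard : ∀ as → hit as ≡ true → Hears 𝓟 (config t) (present t) as u
      heard as hit≡true = hears 𝓟 (config t) (present t) as u (got (covered (present t) u) u-uncovered
        (does⇒ (targetCovered? (suc j) (covered (play (config t) as (present t)))) hit≡true u u+j≡n))
        where
        got : ∀ a {b} → a ≡ false → T (a ∨ b) → b ≡ true
        got false _ b = T⇒≡ b

      -- The target is the only outer node that is awake, and it is not its own speaker.
      speaker-helper : ∀ as → Possible (draws A t) as → (hr : Hears 𝓟 (config t) (present t) as u) → Helper (Hears.speaker hr)
      speaker-helper as possible hr with ℕ.<-≤-connex (toℕ (Hears.speaker hr)) h
      ... | inj₁ v<h = v<h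
      ... | inj₂ h≤v = contradiction speaks (false≢true (asleep-silent t {as} speaker possible
            (≡.trans (≡.cong (λ φ → awake? φ speaker) attacking) (others-asleep {0} {suc j} {speaker} h≤v λ _ v+j≡n →
              distinct (Fin.toℕ-injective (ℕ.+-cancelʳ-≡ (suc j) _ _ (≡.trans v+j≡n (≡.sym u+j≡n))))))))
        where open Hears hr

      -- If exactly one helper transmits, then helpers 0 … M-1 or M … 2M-1 are silent.
      block-quiet : ℕ → Node → Maybe (Action State Msg) → ℝ
      block-quiet lo v x = if block lo M (toℕ v) then quiet x else 1#

      all-quiet : ℕ → Draws → ℝ
      all-quiet lo as = ∏ λ v → block-quiet lo v (lookup as v)

      if-nonneg : ∀ b {x} → 0# ≤ x → 0# ≤ (if b then x else 1#)
      if-nonneg true  0≤x = 0≤x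
      if-nonneg false _   = <⇒≤ 0<1

      if-1≤ : ∀ b {x} → (b ≡ true → 1# ≤ x) → 1# ≤ (if b then x else 1#)
      if-1≤ true  1≤x = 1≤x ≡.refl
      if-1≤ false _   = ≤-refl

      𝔼-block-quiet : ∀ lo → lo ℕ.+ M ℕ.≤ h → 𝔼-joint (draws A t) (all-quiet lo) ≤ e ^ M
      𝔼-block-quiet lo lo+M≤h = begin
        𝔼-joint (draws A t) (all-quiet lo)
          ≈⟨ 𝔼-joint-∏ (draws A t) (block-quiet lo) ⟩
        ∏ (λ v → 𝔼 (draws A t v) (block-quiet lo v))
          ≤⟨ ∏-mono-≤ (λ v → 𝔼-nonneg (proj₁ (draws-independent t v)) λ x → if-nonneg (block lo M (toℕ v)) (0≤indicator _))
                      (λ v → factor v (block lo M (toℕ v)) ≡.refl) ⟩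
        ∏ {n} (λ v → if block lo M (toℕ v) then e else 1#)
          ≈⟨ ∏-block lo M e (ℕ.≤-trans lo+M≤h h≤n) ⟩
        e ^ M ∎
        where
        factor : ∀ v b → block lo M (toℕ v) ≡ b → 𝔼 (draws A t v) (λ x → if b then quiet x else 1#) ≤ (if b then e else 1#)
        factor v true  eq = ≈⇒≤ (same-silence v (ℕ.<-≤-trans (block⇒< lo M (toℕ v) eq) lo+M≤h))
        factor v false eq = ≈⇒≤ (𝔼-const (draws-independent t v) 1#)

    -- `by-density` takes the decision made in `shift` as an argument, so that matching on it
    -- reveals which helpers are in range.
    hit-probability : M ℕ.+ M ℕ.≤ h → 𝔼-joint (draws A t) (λ as → indicator (hit as)) ≤ c
    hit-probability 2M≤h = by-density (<-cotrans c′<c p) λ v → ≡.cong (λ φ → shift φ (length t) (past t) v) attacking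
      where
      by-density : (dec : c′ < p ⊎ p < c) → (∀ v → sh v ≡ crowding dec v) →
        𝔼-joint (draws A t) (λ as → indicator (hit as)) ≤ c
      by-density (inj₂ p<c) sh≡ = begin
        𝔼-joint (draws A t) (λ as → indicator (hit as))
          ≤⟨ 𝔼-joint-mono-≤ (draws-independent t) (λ as possible → indicator-mono (source-speaks as possible)) ⟩
        𝔼-joint (draws A t) (λ as → indicator (sends 𝓟 (lookup as s)))
          ≈⟨ 𝔼-joint-marginal (draws-independent t) s (λ x → indicator (sends 𝓟 x)) ⟩
        𝔼 (draws A t s) (λ x → indicator (sends 𝓟 x))
          ≡⟨ ≡.cong (λ D → 𝔼 D (λ x → indicator (sends 𝓟 x))) (helper-draws s s-helper) ⟩
        𝔼 (push just (behave (length t) (σ s))) (λ x → indicator (sends 𝓟 x))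
          ≈⟨ 𝔼-push just (behave (length t) (σ s)) (λ x → indicator (sends 𝓟 x)) ⟩
        p
          ≤⟨ <⇒≤ p<c ⟩
        c ∎
        where
        source-speaks : ∀ as → Possible (draws A t) as → hit as ≡ true → sends 𝓟 (lookup as s) ≡ true
        -- Any other helper is at rest, hence out of range; a hit therefore costs a transmission of
        -- the source.
        source-speaks as possible hit≡true = ≡.subst (λ x → sends 𝓟 (lookup as x) ≡ true) speaker≡s speaks
          where
          open Hears (heard as hit≡true)
          speaker<h = speaker-helper as possible (heard as hit≡true)
          speaker≡0 : T (toℕ speaker ≡ᵇ 0)
          speaker≡0 = ≡⇒T (≢⇒true λ still → resting-far {sh} {awake? (phase t)} {u} {speaker} speaker<h h≤u
            (≡.trans (sh≡ speaker) still) near)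
          speaker≡s : speaker ≡ s
          speaker≡s = Fin.toℕ-injective (≡.trans (ℕ.≡ᵇ⇒≡ (toℕ speaker) 0 speaker≡0) (≡.sym toℕ-s))
      by-density (inj₁ c′<p) sh≡ = begin
        𝔼-joint (draws A t) (λ as → indicator (hit as))
          ≤⟨ 𝔼-joint-mono-≤ (draws-independent t) (λ as possible → one-block-quiet as possible (hit as) ≡.refl) ⟩
        𝔼-joint (draws A t) (λ as → all-quiet 0 as + all-quiet M as)
          ≈⟨ 𝔼-joint-+ (draws A t) (all-quiet 0) (all-quiet M) ⟩
        𝔼-joint (draws A t) (all-quiet 0) + 𝔼-joint (draws A t) (all-quiet M)
          ≤⟨ +-mono-≤ (𝔼-block-quiet 0 (ℕ.≤-trans (ℕ.m≤m+n M M) 2M≤h)) (𝔼-block-quiet M 2M≤h) ⟩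
        e ^ M + e ^ M
          ≤⟨ crowd c′<p 0≤e (silence+prTransmit (length t) (σ s)) ⟩
        c ∎
        where
        0≤all-quiet : ∀ lo as → 0# ≤ all-quiet lo as
        0≤all-quiet lo as = ∏-nonneg {n} _ λ v → if-nonneg (block lo M (toℕ v)) (0≤indicator _)

        one-block-quiet : ∀ as → Possible (draws A t) as → ∀ b → hit as ≡ b →
          indicator b ≤ all-quiet 0 as + all-quiet M as
        one-block-quiet as possible false _ = +-nonneg (0≤all-quiet 0 as) (0≤all-quiet M as)
        one-block-quiet as possible true hit≡true = split (block 0 M (toℕ speaker)) ≡.refl
          where
          open Hears (heard as hit≡true)

          other-quiet : ∀ v → Helper v → v ≢ speaker → 1# ≤ quiet (lookup as v)
          other-quiet v v<h v≢speaker = still (sends 𝓟 (lookup as v)) ≡.refl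
            where
            still : ∀ b → sends 𝓟 (lookup as v) ≡ b → 1# ≤ indicator (not b)
            still false _      = ≤-refl
            still true  speaks = contradiction (sole v (gap⇒near {sh} {awake? (phase t)} {u} {v}
              (≡.subst (ℕ._≤ K) (gap-sym sh v u) (shifted-gap {sh} {u} {v} v<h h≤u (sh≡ v)))) speaks) v≢speaker

          quiet-block : ∀ lo → lo ℕ.+ M ℕ.≤ h → block lo M (toℕ speaker) ≡ false → 1# ≤ all-quiet lo as
          quiet-block lo lo+M≤h outside = ∏-1≤ {n} λ v → if-1≤ (block lo M (toℕ v)) λ inside →
            other-quiet v (ℕ.<-≤-trans (block⇒< lo M (toℕ v) inside) lo+M≤h)
              λ v≡speaker → false≢true outside (≡.subst (λ x → block lo M (toℕ x) ≡ true) v≡speaker inside)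

          split : ∀ b → block 0 M (toℕ speaker) ≡ b → 1# ≤ all-quiet 0 as + all-quiet M as
          split false outside = ≤-trans (quiet-block 0 (ℕ.≤-trans (ℕ.m≤m+n M M) 2M≤h) outside) (x≤x+y (0≤all-quiet M as))
          split true  inside  = ≤-trans (quiet-block M 2M≤h (¬T⇒≡ λ inside′ →
              ℕ.<⇒≱ (block⇒< 0 M (toℕ speaker) inside) (block⇒≥ M M (toℕ speaker) (T⇒≡ inside′))))
            (≤-trans (x≤x+y (0≤all-quiet 0 as)) (≈⇒≤ (+-comm _ _)))

  -- The potential argument

  0≤growth : 0# ≤ growth
  0≤growth = +-nonneg (<⇒≤ 0<1) (*-nonneg (0≤fromℕ 3) 0≤c)

  1≤growth : 1# ≤ growth
  1≤growth = x≤x+y (*-nonneg (0≤fromℕ 3) 0≤c)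

  -- Silence after the last hit carries no weight, since the problem is then solved; hence 1 without
  -- uncovered nodes, and one silent period fewer than there are nodes otherwise.
  wait-potential : ℕ → ℕ → ℝ
  wait-potential i zero    = 1#
  wait-potential i (suc j) = growth ^ (i ℕ.+ j ℕ.* α) * fromℕ 4 ^ suc j

  potential : Phase → ℝ
  potential gather     = wait-potential α m
  potential (wait i j) = wait-potential i j

  0≤wait-potential : ∀ i j → 0# ≤ wait-potential i j
  0≤wait-potential i zero    = <⇒≤ 0<1
  0≤wait-potential i (suc j) = *-nonneg (^-nonneg (i ℕ.+ j ℕ.* α) 0≤growth) (^-nonneg (suc j) (0≤fromℕ 4))

  0≤potential : ∀ φ → 0# ≤ potential φ
  0≤potential gather     = 0≤wait-potential α m
  0≤potential (wait i j) = 0≤wait-potential i j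

  -- A hit starts α silent slots, which are the next period already counted in the exponent, so the
  -- powers of `growth` agree and only the factor 4 is lost.
  hit-potential : ∀ j → wait-potential 0 (suc j) ≈ fromℕ 4 * wait-potential α j
  hit-potential zero    = trans (*-identityˡ _) refl
  hit-potential (suc j) = solve 3 (λ y f g → y :* (f :* g) := f :* (y :* g)) refl
    (growth ^ (α ℕ.+ j ℕ.* α)) (fromℕ 4) (fromℕ 4 ^ suc j)

  -- One step of a supermartingale argument: `g` is the factor by which a draw may lower the weight,
  -- and its mean must not exceed `growth`.
  average-bound : ∀ k t {x} (g : Draws → ℝ) → 0# ≤ x →
    (∀ as → Possible (draws A t) as → prSolved A k (as ∷ t) * x ≤ growth ^ k * g as) →
    𝔼-joint (draws A t) g ≤ growth → prSolved A (suc k) t * x ≤ growth ^ suc k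
  average-bound k t {x} g 0≤x step g≤growth = begin
    𝔼-joint (draws A t) (λ as → prSolved A k (as ∷ t)) * x
      ≈⟨ *-comm _ x ⟩
    x * 𝔼-joint (draws A t) (λ as → prSolved A k (as ∷ t))
      ≈⟨ 𝔼-joint-* (draws A t) x _ ⟨
    𝔼-joint (draws A t) (λ as → x * prSolved A k (as ∷ t))
      ≤⟨ 𝔼-joint-mono-≤ (draws-independent t) (λ as possible → ≤-trans (≈⇒≤ (*-comm x _)) (step as possible)) ⟩
    𝔼-joint (draws A t) (λ as → growth ^ k * g as)
      ≈⟨ 𝔼-joint-* (draws A t) (growth ^ k) g ⟩
    growth ^ k * 𝔼-joint (draws A t) g
      ≤⟨ *-monoʳ-≤ (^-nonneg k 0≤growth) g≤growth ⟩
    growth ^ k * growth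
      ≈⟨ *-comm _ _ ⟩
    growth ^ suc k ∎

  module _ (fair : Fair) (2M≤h : M ℕ.+ M ℕ.≤ h) where

    unsolved-bound : ∀ t {x} → 0# ≤ x → ¬ Solved (present t) → prSolved A 0 t * x ≤ 1#
    unsolved-bound t {x} 0≤x unsolved = begin
      indicator (does (solved? (at A t))) * x
        ≡⟨ ≡.cong (λ b → indicator b * x) (dec-false (solved? (at A t)) λ solved → unsolved (≡.subst Solved (at≡present t) solved)) ⟩
      0# * x  ≈⟨ zeroˡ x ⟩
      0#      ≤⟨ <⇒≤ 0<1 ⟩
      1#      ∎

    const-bound : ∀ k t {x} y → 0# ≤ x → y ≤ growth →
      (∀ as → Reachable A (as ∷ t) → prSolved A k (as ∷ t) * x ≤ growth ^ k * y) →
      Reachable A t → prSolved A (suc k) t * x ≤ growth ^ suc k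
    const-bound k t y 0≤x y≤growth step reach = average-bound k t (λ _ → y) 0≤x
      (λ as possible → step as (possible ∷ reach))
      (≤-trans (≈⇒≤ (𝔼-joint-const (draws-independent t) y)) y≤growth)

    -- Induction on the remaining slots. At the end an unsolved world contributes 0, and a world
    -- without uncovered nodes has weight 1.
    bound : ∀ k t → Reachable A t → prSolved A k t * potential (phase t) ≤ growth ^ k
    bound zero t _ = by-phase (phase t) (invariant t)
      where
      by-phase : ∀ φ → Invariant φ (present t) → prSolved A 0 t * potential φ ≤ 1#
      by-phase gather inv =
        let v , _ , v-uncovered = helper-uncovered {present t} (phase-invariant inv)
        in unsolved-bound t (0≤potential gather) (uncovered-unsolved inv (v , v-uncovered))
      by-phase (wait i zero) inv = ≤-trans (≈⇒≤ (*-identityʳ _)) (indicator≤1 _)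
      by-phase (wait i (suc j)) inv =
        let v , _ , _ , v-uncovered = target-uncovered {i} {j} {present t} (phase-invariant inv)
        in unsolved-bound t (0≤potential (wait i (suc j))) (uncovered-unsolved inv (v , v-uncovered))
    bound (suc k) t reach = by-phase (phase t) ≡.refl
      where
      phase-next : ∀ {φ} → phase t ≡ φ → ∀ as → phase (as ∷ t) ≡ next-phase φ (covered (past (as ∷ t)))
      phase-next eq as = ≡.cong (λ φ → next-phase φ (covered (past (as ∷ t)))) eq

      unchanged : ∀ {x} → 0# ≤ x →
        (∀ as → potential (phase (as ∷ t)) ≡ x) → prSolved A (suc k) t * x ≤ growth ^ suc k
      unchanged {x} 0≤x same = const-bound k t 1# 0≤x 1≤growth
        (λ as reach′ → ≤-trans
          (≡.subst (λ z → prSolved A k (as ∷ t) * z ≤ growth ^ k) (same as) (bound k (as ∷ t) reach′))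
          (≈⇒≤ (sym (*-identityʳ _))))
        reach

      by-phase : ∀ φ → phase t ≡ φ → prSolved A (suc k) t * potential φ ≤ growth ^ suc k
      by-phase gather eq = unchanged (0≤potential gather) λ as →
        ≡.trans (≡.cong potential (phase-next eq as)) (either (does (helpersCovered? (covered (past (as ∷ t))))))
        where
        either : ∀ b → potential (if b then wait α m else gather) ≡ wait-potential α m
        either true  = ≡.refl
        either false = ≡.refl
      by-phase (wait (suc i) zero) eq = unchanged (0≤potential (wait 0 0)) λ as → ≡.cong potential (phase-next eq as)
      by-phase (wait zero zero)    eq = unchanged (0≤potential (wait 0 0)) λ as → ≡.cong potential (phase-next eq as)
      -- A silent slot lowers the weight by exactly `growth`, with certainty.
      by-phase (wait (suc i) (suc j)) eq = const-bound k t growth (0≤potential (wait (suc i) (suc j))) ≤-refl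
        (λ as reach′ → begin
          prSolved A k (as ∷ t) * (growth * growth ^ (i ℕ.+ j ℕ.* α) * fromℕ 4 ^ suc j)
            ≈⟨ solve 4 (λ p y z f → p :* (y :* z :* f) := p :* (z :* f) :* y) refl
                 (prSolved A k (as ∷ t)) growth (growth ^ (i ℕ.+ j ℕ.* α)) (fromℕ 4 ^ suc j) ⟩
          prSolved A k (as ∷ t) * wait-potential i (suc j) * growth
            ≤⟨ *-monoˡ-≤ 0≤growth (≡.subst (λ φ → prSolved A k (as ∷ t) * potential φ ≤ growth ^ k)
                 (phase-next eq as) (bound k (as ∷ t) reach′)) ⟩
          growth ^ k * growth ∎)
        reach
      by-phase (wait zero (suc j)) eq = attack t reach eq (λ as reach′ →
          ≡.subst (λ φ → prSolved A k (as ∷ t) * potential φ ≤ growth ^ k) (phase-next eq as) (bound k (as ∷ t) reach′))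
        where
        attack : ∀ t → Reachable A t → phase t ≡ wait 0 (suc j) →
          (∀ as → Reachable A (as ∷ t) →
            prSolved A k (as ∷ t) * potential (next-phase (wait 0 (suc j)) (covered (past (as ∷ t)))) ≤ growth ^ k) →
          prSolved A (suc k) t * wait-potential 0 (suc j) ≤ growth ^ suc k
        -- The factor is 1 on a miss, where the weight stays, and 4 on a hit, as computed in
        -- `hit-potential`.
        attack (as₀ ∷ t₀) reach eq IH = average-bound k (as₀ ∷ t₀) (λ as → 1# + fromℕ 3 * indicator (hit as))
          (0≤wait-potential 0 (suc j)) (λ as possible → step as (hit as) (IH as (possible ∷ reach))) (begin
            𝔼-joint (draws A t′) (λ as → 1# + fromℕ 3 * indicator (hit as))
              ≈⟨ 𝔼-joint-+ (draws A t′) (λ _ → 1#) _ ⟩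
            𝔼-joint (draws A t′) (λ _ → 1#) + 𝔼-joint (draws A t′) (λ as → fromℕ 3 * indicator (hit as))
              ≈⟨ +-cong (𝔼-joint-const (draws-independent t′) 1#) (𝔼-joint-* (draws A t′) (fromℕ 3) _) ⟩
            1# + fromℕ 3 * 𝔼-joint (draws A t′) (λ as → indicator (hit as))
              ≤⟨ +-monoʳ-≤ 1# (*-monoʳ-≤ (0≤fromℕ 3) (hit-probability 2M≤h)) ⟩
            growth ∎)
          where
          open Attack fair as₀ t₀ reach j eq
          t′ = as₀ ∷ t₀
          step : ∀ as b → prSolved A k (as ∷ t′) * potential (if b then wait α j else wait 0 (suc j)) ≤ growth ^ k →
            prSolved A k (as ∷ t′) * wait-potential 0 (suc j) ≤ growth ^ k * (1# + fromℕ 3 * indicator b)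
          step as true  ih = begin
            prSolved A k (as ∷ t′) * wait-potential 0 (suc j)
              ≈⟨ trans (*-congˡ (hit-potential j)) (solve 3 (λ p f w → p :* (f :* w) := p :* w :* f) refl _ (fromℕ 4) (wait-potential α j)) ⟩
            prSolved A k (as ∷ t′) * wait-potential α j * fromℕ 4
              ≤⟨ *-monoˡ-≤ (0≤fromℕ 4) ih ⟩
            growth ^ k * fromℕ 4
              ≈⟨ *-congˡ (+-congˡ (*-identityʳ (fromℕ 3))) ⟨
            growth ^ k * (1# + fromℕ 3 * 1#) ∎
          step as false ih = ≤-trans ih (≈⇒≤ (sym (trans (*-congˡ (trans (+-congˡ (zeroʳ (fromℕ 3))) (+-identityʳ 1#))) (*-identityʳ _))))

    solved-bound : 0 ℕ.< m → ∀ T → prSolvedWithin A T * (growth ^ (α ℕ.* m) * fromℕ 4 ^ m) ≤ growth ^ T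
    solved-bound 0<m T = ≡.subst (λ x → prSolvedWithin A T * x ≤ growth ^ T) (initial 0<m) (bound T [] [])
      where
      -- The exponent is α + (m - 1) α, which equals α m for positive m.
      initial : ∀ {m} → 0 ℕ.< m → wait-potential α m ≡ growth ^ (α ℕ.* m) * fromℕ 4 ^ m
      initial {suc m} _ = ≡.cong (λ k → growth ^ k * fromℕ 4 ^ suc m) (ℕ.*-comm (suc m) α)

-- Rounding of halves, and the assembly of the theorem

⌈n/2⌉≤1+⌊n/2⌋ : ∀ n → ⌈ n /2⌉ ℕ.≤ suc ⌊ n /2⌋
⌈n/2⌉≤1+⌊n/2⌋ n = ℕ.⌊n/2⌋-mono (ℕ.n≤1+n (suc n))

2*⌊n/2⌋≤n : ∀ n → ⌊ n /2⌋ ℕ.+ ⌊ n /2⌋ ℕ.≤ n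
2*⌊n/2⌋≤n n = ℕ.≤-trans (ℕ.+-monoʳ-≤ ⌊ n /2⌋ (ℕ.⌊n/2⌋≤⌈n/2⌉ n)) (ℕ.≤-reflexive (ℕ.⌊n/2⌋+⌈n/2⌉≡n n))

n≤2*⌈n/2⌉ : ∀ n → n ℕ.≤ ⌈ n /2⌉ ℕ.+ ⌈ n /2⌉
n≤2*⌈n/2⌉ n = ℕ.≤-trans (ℕ.≤-reflexive (≡.sym (ℕ.⌊n/2⌋+⌈n/2⌉≡n n))) (ℕ.+-monoˡ-≤ ⌈ n /2⌉ (ℕ.⌊n/2⌋≤⌈n/2⌉ n))

n≤1+2*⌊n/2⌋ : ∀ n → n ℕ.≤ suc (⌊ n /2⌋ ℕ.+ ⌊ n /2⌋)
n≤1+2*⌊n/2⌋ n = ℕ.≤-trans (ℕ.≤-reflexive (≡.sym (ℕ.⌊n/2⌋+⌈n/2⌉≡n n)))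
  (ℕ.≤-trans (ℕ.+-monoʳ-≤ ⌊ n /2⌋ (⌈n/2⌉≤1+⌊n/2⌋ n)) (ℕ.≤-reflexive (ℕ.+-suc _ _)))

-- Halving twice loses at most 3, so n ≤ 4M + 3, and M ≥ 1 absorbs the 3.
n≤7*⌊n/4⌋ : ∀ {n} → 4 ℕ.≤ n → n ℕ.≤ 7 ℕ.* ⌊ ⌊ n /2⌋ /2⌋
n≤7*⌊n/4⌋ {n} 4≤n = begin
  n                                                                 ≤⟨ n≤1+2*⌊n/2⌋ n ⟩
  1 ℕ.+ (h ℕ.+ h)                                                   ≤⟨ ℕ.+-monoʳ-≤ 1 (ℕ.+-mono-≤ (n≤1+2*⌊n/2⌋ h) (n≤1+2*⌊n/2⌋ h)) ⟩
  1 ℕ.+ (1 ℕ.+ (M ℕ.+ M) ℕ.+ (1 ℕ.+ (M ℕ.+ M)))                     ≤⟨ ℕ.+-mono-≤ 1≤M (ℕ.+-mono-≤ (ℕ.+-monoˡ-≤ _ 1≤M) (ℕ.+-monoˡ-≤ _ 1≤M)) ⟩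
  M ℕ.+ (M ℕ.+ (M ℕ.+ M) ℕ.+ (M ℕ.+ (M ℕ.+ M)))                     ≡⟨ 7-copies M ⟩
  7 ℕ.* M                                                           ∎
  where
  open ℕ.≤-Reasoning
  open import Data.Nat.Solver using (module +-*-Solver)
  h = ⌊ n /2⌋
  M = ⌊ h /2⌋
  1≤M : 1 ℕ.≤ M
  1≤M = ℕ.⌊n/2⌋-mono (ℕ.⌊n/2⌋-mono 4≤n)
  7-copies : ∀ M → M ℕ.+ (M ℕ.+ (M ℕ.+ M) ℕ.+ (M ℕ.+ (M ℕ.+ M))) ≡ 7 ℕ.* M
  7-copies = let open +-*-Solver in solve 1 (λ M → M :+ (M :+ (M :+ M) :+ (M :+ (M :+ M))) := con 7 :* M) ≡.refl

theorem9 : (R : Reals) → let open Reals R in let open RealFunctions R in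
    ∀ (n : ℕ) → 24 ℕ.< n →
    ∀ (r d : ℝ) → 0# < r → r < d →
    ∀ (α β : ℕ) → 0 ℕ.< β →
    ∀ (π Vmax : ℝ) → IsPi π → π * r < fromℕ (6 ℕ.* α) * Vmax →
    let open Geocast R n r d Vmax in
    ∀ (𝓟 : Protocol) → let open Execution 𝓟 in
    Conditional → Fair →
    ∀ (ℓ q ρ : ℝ) → IsLn (fromℕ n /ℕ 2) ℓ →
    q * (fromℕ 96 * ℓ) ≈ fromℕ (n ℕ.^ 2) →
    IsSqrt ((1# /ℕ 2) ^ n) ρ →
    ∃[ A ] (Legal A × Connected α β A ×
    (∀ (T : ℕ) → ρ ≤ prSolvedWithin A T →
    fromℕ (α ℕ.* n) /ℕ 2 + q ≤ fromℕ T))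
theorem9 R n 24<n r d 0<r r<d α β 0<β π Vmax (0<π , _) πr<6αVmax 𝓟 _ fair ℓ q ρ ln qℓ sqrt =
  A , legal , (λ ω _ t _ → connected ω β 0<β t) , λ T →
    time-bound n m α (n≤2*⌈n/2⌉ n) (*-nonneg (0≤fromℕ 3) 0≤c) sqrt (threshold-rate n 4<n ln qℓ M n≤7M sign)
      -- Two disjoint blocks of M nodes fit among the h helpers, and at least one node remains to be
      -- attacked.
      T (solved-bound fair (2*⌊n/2⌋≤n h) (ℕ.⌊n/2⌋-mono (ℕ.≤-trans 2≤n (ℕ.n≤1+n n))) T)
  where
  open Reals R using (0#; _<_)
  open OrderedFieldProperties R
  open HitRates R
  instance
    n-nonZero : NonZero n
    n-nonZero = ℕ.>-nonZero (ℕ.≤-trans (ℕ.s≤s ℕ.z≤n) 24<n)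
  h m M : ℕ
  h = ⌊ n /2⌋
  m = ⌈ n /2⌉
  M = ⌊ h /2⌋
  4<n : 4 ℕ.< n
  4<n = ℕ.≤-trans (ℕ.m≤m+n 5 20) 24<n
  2≤n : 2 ℕ.≤ n
  2≤n = ℕ.≤-trans (ℕ.m≤m+n 2 3) 4<n
  n≤7M : n ℕ.≤ 7 ℕ.* M
  n≤7M = n≤7*⌊n/4⌋ (ℕ.<⇒≤ 4<n)
  sign = ℓ-sign n 4<n ln qℓ
  0<Vmax : 0# < Vmax
  -- The product 6α · Vmax exceeds π r > 0 and its first factor is nonnegative, so the speed bound
  -- is positive.
  0<Vmax = *-pos⁻¹ (0≤fromℕ (6 ℕ.* α)) (<-trans (Reals.*-pos R 0<π 0<r) πr<6αVmax)
  open Threshold (threshold n 4<n ln qℓ M n≤7M sign) using (0≤c)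
  open Strategy R n r d Vmax 𝓟 (LatticePoints.scale R n 0<r r<d 0<Vmax) h m M α
    (ℕ.⌊n/2⌋+⌈n/2⌉≡n n) (ℕ.⌊n/2⌋-mono (ℕ.<⇒≤ 4<n)) (threshold n 4<n ln qℓ M n≤7M sign)
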